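{- For every prime number $p>2$, each of the following polynomials is irreducible over $\mathbb{Q}$: $D_p(x)/D_1(x)$ (Lucas), $Q_p(x)/Q_1(x)$ (Pell-Lucas), $\vartheta_p(x)/\vartheta_1(x)$ (Fermat-Lucas), $T_p(x)/T_1(x)$ (Chebyshev first kind), $C_p(x)/C_1(x)$ (Morgan-Voyce, Lucas type), and $v_p(x)/v_1(x)$ (Vieta-Lucas).
   Context: The polynomial sequences are defined for $n\ge 2$ by: Lucas: $D_0=2$, $D_1=x$, $D_n(x)=xD_{n-1}(x)+D_{n-2}(x)$; Pell-Lucas: $Q_0=2$, $Q_1=2x$, $Q_n(x)=2xQ_{n-1}(x)+Q_{n-2}(x)$; Fermat-Lucas: $\vartheta_0=2$, $\vartheta_1=3x$, $\vartheta_n(x)=3x\vartheta_{n-1}(x)-2\vartheta_{n-2}(x)$; Chebyshev first kind: $T_0=1$, $T_1=x$, $T_n(x)=2xT_{n-1}(x)-T_{n-2}(x)$; Morgan-Voyce (Lucas type): $C_0=2$, $C_1=x+2$, $C_n(x)=(x+2)C_{n-1}(x)-C_{n-2}(x)$; Vieta-Lucas: $v_0=2$, $v_1=x$, $v_n(x)=xv_{n-1}(x)-v_{n-2}(x)$. -}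

module Defs where

open import Algebra.Bundles.Raw using (RawRing)
open import Data.Integer.Base using (ℤ; +_)
open import Data.List.Base using (List; []; _∷_; map)
open import Data.Nat.Base using (ℕ; zero; suc)
open import Data.Product.Base using (Σ-syntax)
open import Data.Rational.Base as ℚ using (ℚ; 0ℚ; 1ℚ)
open import Level using (0ℓ)
open import Relation.Binary.PropositionalEquality using (_≡_)

infixl 7 _*ᵖ_
infixl 6 _+ᵖ_ _-ᵖ_
infix  8 -ᵖ_
infix  4 _≈ᵖ_

-- The list a₀ ∷ a₁ ∷ … ∷ aₘ ∷ [] denotes a₀ + a₁X + … + aₘXᵐ.  Trailing
-- zeros are allowed, so equality of polynomials is _≈ᵖ_ rather than _≡_.
ℚ[X] : Set
ℚ[X] = List ℚ

coeff : ℚ[X] → ℕ → ℚ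
coeff []      _       = 0ℚ
coeff (a ∷ f) zero    = a
coeff (a ∷ f) (suc n) = coeff f n

_≈ᵖ_ : ℚ[X] → ℚ[X] → Set
f ≈ᵖ g = ∀ n → coeff f n ≡ coeff g n

_+ᵖ_ : ℚ[X] → ℚ[X] → ℚ[X]
[]      +ᵖ g       = g
(a ∷ f) +ᵖ []      = a ∷ f
(a ∷ f) +ᵖ (b ∷ g) = (a ℚ.+ b) ∷ (f +ᵖ g)

-ᵖ_ : ℚ[X] → ℚ[X]
-ᵖ f = map (λ a → ℚ.- a) f

_-ᵖ_ : ℚ[X] → ℚ[X] → ℚ[X]
f -ᵖ g = f +ᵖ (-ᵖ g)

-- (a + X f) g = a g + X (f g)
_*ᵖ_ : ℚ[X] → ℚ[X] → ℚ[X]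
[]      *ᵖ g = []
(a ∷ f) *ᵖ g = map (a ℚ.*_) g +ᵖ (0ℚ ∷ (f *ᵖ g))

ℚ[X]-rawRing : RawRing 0ℓ 0ℓ
ℚ[X]-rawRing = record
  { Carrier = ℚ[X]
  ; _≈_     = _≈ᵖ_
  ; _+_     = _+ᵖ_
  ; _*_     = _*ᵖ_
  ; -_      = -ᵖ_
  ; 0#      = []
  ; 1#      = 1ℚ ∷ []
  }

open import Algebra.Definitions.RawSemiring (RawRing.rawSemiring ℚ[X]-rawRing)
  using (_∣_; Irreducible)
open import Algebra.Definitions.RawMagma (RawRing.*-rawMagma ℚ[X]-rawRing)
  using (module _∣ʳ_)

-- g divides f in ℚ[X] and the quotient f / g is irreducible.  The quotient is
-- determined up to _≈ᵖ_ by f and g as soon as g is not the zero polynomial.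
IrreducibleQuotient : ℚ[X] → ℚ[X] → Set
IrreducibleQuotient f g = Σ[ g∣f ∈ g ∣ f ] Irreducible (_∣ʳ_.quotient g∣f)

X : ℚ[X]
X = 0ℚ ∷ 1ℚ ∷ []

const : ℤ → ℚ[X]
const k = (k ℚ./ 1) ∷ []

lucas : ℕ → ℚ[X]
lucas 0             = const (+ 2)
lucas 1             = X
lucas (suc (suc n)) = X *ᵖ lucas (suc n) +ᵖ lucas n

pellLucas : ℕ → ℚ[X]
pellLucas 0             = const (+ 2)
pellLucas 1             = const (+ 2) *ᵖ X
pellLucas (suc (suc n)) = const (+ 2) *ᵖ X *ᵖ pellLucas (suc n) +ᵖ pellLucas n

fermatLucas : ℕ → ℚ[X]
fermatLucas 0             = const (+ 2)
fermatLucas 1             = const (+ 3) *ᵖ X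
fermatLucas (suc (suc n)) =
  const (+ 3) *ᵖ X *ᵖ fermatLucas (suc n) -ᵖ const (+ 2) *ᵖ fermatLucas n

chebyshevT : ℕ → ℚ[X]
chebyshevT 0             = const (+ 1)
chebyshevT 1             = X
chebyshevT (suc (suc n)) = const (+ 2) *ᵖ X *ᵖ chebyshevT (suc n) -ᵖ chebyshevT n

-- The Lucas-type Morgan-Voyce polynomials Cₙ.
morganVoyceC : ℕ → ℚ[X]
morganVoyceC 0             = const (+ 2)
morganVoyceC 1             = X +ᵖ const (+ 2)
morganVoyceC (suc (suc n)) =
  (X +ᵖ const (+ 2)) *ᵖ morganVoyceC (suc n) -ᵖ morganVoyceC n

vietaLucas : ℕ → ℚ[X]
vietaLucas 0             = const (+ 2)
vietaLucas 1             = X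
vietaLucas (suc (suc n)) = X *ᵖ vietaLucas (suc n) -ᵖ vietaLucas n

{-# OPTIONS --safe #-}
module Submission where

-- Each of the six sequences is, up to a scalar and an invertible affine change
-- of variable, the sequence W₀ = 2, W₁ = X, Wₙ₊₂ = X Wₙ₊₁ + b Wₙ for some b in
-- {1, -1, -2}.  The coefficient of X^i in W_(i+2j) is b^j times
-- (i+2j)/(i+j) · C(i+j, j), so for an odd prime p the polynomial W_p / X is
-- monic, p divides its other coefficients, and its constant term is
-- p b^((p-1)/2).  Eisenstein's criterion applies since p does not divide b, and
-- substituting an invertible affine polynomial preserves irreducibility.

open import Defs
open import Algebra.Bundles using (CommutativeRing)
open import Algebra.Bundles.Raw using (RawRing)
import Algebra.Definitions.RawSemiring as RawSemiringDefinitions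
open import Algebra.Definitions.RawSemiring (RawRing.rawSemiring ℚ[X]-rawRing)
  using (Irreducible) renaming (_∣_ to _∣ᵖ_)
open import Algebra.Morphism.Structures using (module SemiringMorphisms)
import Algebra.Properties.CommutativeSemigroup as CommutativeSemigroupProperties
open import Data.Integer.Base as ℤ using (ℤ; +_; -[1+_]; 0ℤ; 1ℤ)
open import Data.Integer.Divisibility.Signed as ℤ using (_∣_; divides)
import Data.Integer.Properties as ℤ
open import Data.List.Base using ([]; _∷_; map; length; drop)
open import Data.Nat.Base as ℕ using (ℕ; zero; suc; _<_; _≤_; _>_; z≤n; s≤s; z<s)
import Data.Nat.Divisibility as ℕ
open import Data.Nat.Induction using (<-wellFounded)
open import Data.Nat.Primality
  using (Prime; euclidsLemma; prime⇒irreducible; prime⇒nonTrivial; prime⇒nonZero)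
import Data.Nat.Properties as ℕ
open import Data.Nat.Tactic.RingSolver using (solve-∀)
open import Data.Product.Base using (_×_; _,_; ∃; ∃₂)
open import Data.Rational.Base as ℚ using (ℚ; 0ℚ; 1ℚ)
import Data.Rational.Properties as ℚ
open import Data.Rational.Unnormalised.Base as ℚᵘ using (mkℚᵘ; *≡*)
import Data.Rational.Unnormalised.Properties as ℚᵘ
open import Data.Sum.Base as Sum using (_⊎_; inj₁; inj₂; [_,_]′; map₁; map₂)
open import Function.Base using (_∘_)
open import Induction.WellFounded using (Acc; acc)
open import Level using (0ℓ)
open import Relation.Binary.PropositionalEquality
  using (_≡_; _≢_; refl; sym; trans; cong; cong₂; subst; module ≡-Reasoning)
import Relation.Binary.Reasoning.Setoid as SetoidReasoning
open import Relation.Nullary using (¬_; yes; no; contradiction)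

-- Products of power series

-- The passage from ℤ to ℚ avoids contents and primitive parts. Clearing denominators in a
-- factorisation r = x y leaves an integral identity `f ⋆ g ≡ c * F` with an uncontrolled nonzero
-- scale c. Only the prime p has to be removed from c: while p divides c, Gauss's lemma modulo p
-- cancels it against f or g. The other primes dividing c may stay, since they are units modulo p.
-- What is extracted is that f or g has a nonzero coefficient at the degree n of F; this survives
-- rescaling, so it holds for x or y as well and forces the other factor to be constant. Lists may
-- end in zeros, so no degree can be read off a polynomial. The integral argument therefore runs on
-- coefficient functions with a mere bound on the support, and degrees over ℚ are searched for. For
-- the six sequences, the scalar occurs in both numerator and denominator of the quotient and
-- cancels, so the quotient is exactly the image of W_p / X under an automorphism of ℚ[X].

module Convolution {c ℓ} (R : CommutativeRing c ℓ) where

  open CommutativeRing R hiding (zero) renaming (refl to ≈-refl; sym to ≈-sym; trans to ≈-trans)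
  open SetoidReasoning setoid
  open CommutativeSemigroupProperties +-commutativeSemigroup
    using () renaming (interchange to +-interchange; x∙yz≈y∙xz to x+[y+z]≈y+[x+z])
  infix 4 _≋_
  infixl 7 _⋆_

  _≋_ : (f g : ℕ → Carrier) → Set ℓ
  f ≋ g = ∀ n → f n ≈ g n

  -- The coefficients of a product of formal power series.
  _⋆_ : (ℕ → Carrier) → (ℕ → Carrier) → ℕ → Carrier
  (f ⋆ g) zero    = f 0 * g 0
  (f ⋆ g) (suc n) = f 0 * g (suc n) + ((f ∘ suc) ⋆ g) n

  ⋆-cong : ∀ {f f′ g g′} → f ≋ f′ → g ≋ g′ → f ⋆ g ≋ f′ ⋆ g′
  ⋆-cong p q zero    = *-cong (p 0) (q 0)
  ⋆-cong p q (suc n) = +-cong (*-cong (p 0) (q (suc n))) (⋆-cong (p ∘ suc) q n)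

  ⋆-zeroˡ : ∀ {f} g → (∀ n → f n ≈ 0#) → ∀ n → (f ⋆ g) n ≈ 0#
  ⋆-zeroˡ g p zero    = ≈-trans (*-congʳ (p 0)) (zeroˡ _)
  ⋆-zeroˡ g p (suc n) = ≈-trans (+-cong (≈-trans (*-congʳ (p 0)) (zeroˡ _)) (⋆-zeroˡ g (p ∘ suc) n)) (+-identityˡ 0#)

  ⋆-distribʳ : ∀ h f g → (λ n → f n + g n) ⋆ h ≋ λ n → (f ⋆ h) n + (g ⋆ h) n
  ⋆-distribʳ h f g zero    = distribʳ (h 0) (f 0) (g 0)
  ⋆-distribʳ h f g (suc n) = ≈-trans
    (+-cong (distribʳ (h (suc n)) (f 0) (g 0)) (⋆-distribʳ h (f ∘ suc) (g ∘ suc) n))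
    (+-interchange _ _ _ _)

  *-⋆-assoc : ∀ a f g → (λ n → a * f n) ⋆ g ≋ λ n → a * (f ⋆ g) n
  *-⋆-assoc a f g zero    = *-assoc a (f 0) (g 0)
  *-⋆-assoc a f g (suc n) = ≈-trans
    (+-cong (*-assoc a (f 0) (g (suc n))) (*-⋆-assoc a (f ∘ suc) g n))
    (≈-sym (distribˡ a _ _))

  -- The definition of `⋆` peels off the head of the left factor; this peels off the head of the
  -- right one, which is what commutativity compares it with.
  ⋆-suc : ∀ f g n → (f ⋆ g) (suc n) ≈ f (suc n) * g 0 + (f ⋆ (g ∘ suc)) n
  ⋆-suc f g zero    = +-comm _ _
  ⋆-suc f g (suc n) = ≈-trans (+-congˡ (⋆-suc (f ∘ suc) g n)) (x+[y+z]≈y+[x+z] _ _ _)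

  ⋆-comm : ∀ f g → f ⋆ g ≋ g ⋆ f
  ⋆-comm f g zero    = *-comm (f 0) (g 0)
  ⋆-comm f g (suc n) = ≈-trans
    (+-cong (*-comm (f 0) (g (suc n))) (⋆-comm (f ∘ suc) g n))
    (≈-sym (⋆-suc g f n))

  ⋆-assoc : ∀ f g h → (f ⋆ g) ⋆ h ≋ f ⋆ (g ⋆ h)
  ⋆-assoc f g h zero    = *-assoc (f 0) (g 0) (h 0)
  ⋆-assoc f g h (suc n) = begin
    f 0 * g 0 * h (suc n) + ((λ m → f 0 * g (suc m) + ((f ∘ suc) ⋆ g) m) ⋆ h) n
      ≈⟨ +-cong (*-assoc _ _ _) (⋆-distribʳ h (λ m → f 0 * g (suc m)) ((f ∘ suc) ⋆ g) n) ⟩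
    f 0 * (g 0 * h (suc n)) + (((λ m → f 0 * g (suc m)) ⋆ h) n + (((f ∘ suc) ⋆ g) ⋆ h) n)
      ≈⟨ +-congˡ (+-cong (*-⋆-assoc (f 0) (g ∘ suc) h n) (⋆-assoc (f ∘ suc) g h n)) ⟩
    f 0 * (g 0 * h (suc n)) + (f 0 * ((g ∘ suc) ⋆ h) n + ((f ∘ suc) ⋆ (g ⋆ h)) n)
      ≈⟨ +-assoc _ _ _ ⟨
    f 0 * (g 0 * h (suc n)) + f 0 * ((g ∘ suc) ⋆ h) n + ((f ∘ suc) ⋆ (g ⋆ h)) n
      ≈⟨ +-congʳ (distribˡ (f 0) _ _) ⟨
    f 0 * (g ⋆ h) (suc n) + ((f ∘ suc) ⋆ (g ⋆ h)) n
      ∎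

  ⋆-top : ∀ {f g} m k → (∀ {i} → m ℕ.< i → f i ≈ 0#) → (∀ {j} → k ℕ.< j → g j ≈ 0#) →
          (f ⋆ g) (m ℕ.+ k) ≈ f m * g k
  ⋆-top {f} {g} zero zero f> g> = ≈-refl
  ⋆-top {f} {g} zero (suc k) f> g> =
    ≈-trans (+-congˡ (⋆-zeroˡ g (λ n → f> (ℕ.s≤s ℕ.z≤n)) k)) (+-identityʳ _)
  ⋆-top {f} {g} (suc m) k f> g> = ≈-trans
    (+-cong (≈-trans (*-congˡ (g> (ℕ.s≤s (ℕ.m≤n+m k m)))) (zeroʳ _))
            (⋆-top m k (λ m<i → f> (ℕ.s≤s m<i)) g>))
    (+-identityˡ _)

-- Eisenstein's criterion over ℤ

module ℤ[[X]] = Convolution ℤ.+-*-commutativeRing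

module Eisenstein (p : ℕ) (p-prime : Prime p) where

  open import Data.Integer.Base using (_*_)
  open ℤ[[X]] using (_⋆_; ⋆-comm; ⋆-cong; *-⋆-assoc)

  P : ℤ
  P = + p

  instance
    P-nonZero : ℤ.NonZero P
    P-nonZero = prime⇒nonZero p-prime

  P∣x*y⇒P∣x⊎P∣y : ∀ x y → P ∣ x * y → P ∣ x ⊎ P ∣ y
  P∣x*y⇒P∣x⊎P∣y x y P∣xy
    with euclidsLemma ℤ.∣ x ∣ ℤ.∣ y ∣ p-prime (subst (p ℕ.∣_) (ℤ.abs-* x y) (ℤ.∣⇒∣ᵤ P∣xy))
  ... | inj₁ p∣x = inj₁ (ℤ.∣ᵤ⇒∣ p∣x)
  ... | inj₂ p∣y = inj₂ (ℤ.∣ᵤ⇒∣ p∣y)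

  P∤x*y : ∀ {x y} → ¬ P ∣ x → ¬ P ∣ y → ¬ P ∣ x * y
  P∤x*y {x} {y} P∤x P∤y = [ P∤x , P∤y ]′ ∘ P∣x*y⇒P∣x⊎P∣y x y

  P∣f⋆g : ∀ {f g} n → (∀ {j} → j ≤ n → P ∣ g j) → P ∣ (f ⋆ g) n
  P∣f⋆g {f} zero    P∣g = ℤ.∣n⇒∣m*n (f 0) (P∣g z≤n)
  P∣f⋆g {f} {g} (suc n) P∣g = ℤ.∣m∣n⇒∣m+n
    (ℤ.∣n⇒∣m*n (f 0) (P∣g ℕ.≤-refl)) (P∣f⋆g n (λ j≤n → P∣g (ℕ.m≤n⇒m≤1+n j≤n)))

  -- In coefficient m + k, every term other than `f m * g k` has a left index below m or a right
  -- index below k, so it vanishes modulo P. This is the counterpart of `⋆-top` at the low end.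
  ⋆-bottom : ∀ {f g} m k → (∀ {i} → i < m → P ∣ f i) → (∀ {j} → j < k → P ∣ g j) →
             P ∣ (f ⋆ g) (m ℕ.+ k) → P ∣ f m * g k
  ⋆-bottom zero    zero    f< g< h = h
  ⋆-bottom {f} zero (suc k) f< g< h = ℤ.∣m+n∣n⇒∣m h (P∣f⋆g k (λ j≤k → g< (s≤s j≤k)))
  ⋆-bottom {f} {g} (suc m) k       f< g< h =
    ⋆-bottom m k (λ i<m → f< (s≤s i<m)) g< (ℤ.∣m+n∣m⇒∣n h (ℤ.∣m⇒∣m*n (g (suc m ℕ.+ k)) (f< z<s)))

  bottom : ∀ (f : ℕ → ℤ) N →
           (∀ {i} → i < N → P ∣ f i) ⊎ ∃ λ m → m < N × (∀ {i} → i < m → P ∣ f i) × ¬ P ∣ f m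
  bottom f zero = inj₁ λ ()
  bottom f (suc N) with bottom f N
  ... | inj₂ (m , m<N , f< , P∤fm) = inj₂ (m , ℕ.m<n⇒m<1+n m<N , f< , P∤fm)
  ... | inj₁ f<N with P ℤ.∣? f N
  ...   | no P∤fN = inj₂ (N , ℕ.≤-refl , f<N , P∤fN)
  ...   | yes P∣fN = inj₁ λ {i} i<1+N →
          [ f<N , (λ i≡N → subst (λ j → P ∣ f j) (sym i≡N) P∣fN) ]′ (ℕ.m≤n⇒m<n∨m≡n (ℕ.s≤s⁻¹ i<1+N))

  -- The bound need not be sharp: it makes the search in `bottom` finite, and the length of a list
  -- can serve as N.
  VanishesFrom : ℕ → (ℕ → ℤ) → Set
  VanishesFrom N f = ∀ {i} → N ≤ i → f i ≡ 0ℤ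

  P∣-beyond : ∀ {f : ℕ → ℤ} N → VanishesFrom N f → (∀ {i} → i < N → P ∣ f i) → ∀ i → P ∣ f i
  P∣-beyond N f≥N f<N i with i ℕ.<? N
  ... | yes i<N = f<N i<N
  ... | no i≮N = subst (P ∣_) (sym (f≥N (ℕ.≮⇒≥ i≮N))) (divides 0ℤ refl)

  -- Polynomials over the field with p elements have no zero divisors. The lowest coefficients prime
  -- to P are compared, since `bottom` finds them by searching upwards from 0.
  gauss : ∀ {f g : ℕ → ℤ} M N → VanishesFrom M f → VanishesFrom N g → (∀ n → P ∣ (f ⋆ g) n) →
          (∀ i → P ∣ f i) ⊎ (∀ j → P ∣ g j)
  gauss {f} {g} M N f≥M g≥N P∣fg with bottom f M | bottom g N
  ... | inj₁ f<M | _ = inj₁ (P∣-beyond M f≥M f<M)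
  ... | inj₂ _ | inj₁ g<N = inj₂ (P∣-beyond N g≥N g<N)
  ... | inj₂ (m , _ , f<m , P∤fm) | inj₂ (k , _ , g<k , P∤gk) =
    contradiction (⋆-bottom {f} {g} m k f<m g<k (P∣fg (m ℕ.+ k))) (P∤x*y {f m} {g k} P∤fm P∤gk)

  -- The last three fields say that P divides `F 0` exactly once; naming the quotient lets P be
  -- cancelled from an equation between constant terms. Vanishing beyond n is a separate hypothesis
  -- of `eisenstein⇒irreducible`.
  record IsEisenstein (F : ℕ → ℤ) (n : ℕ) : Set where
    field
      P∣F< : ∀ {i} → i < n → P ∣ F i
      P∤Fₙ : ¬ P ∣ F n
      F₀/P : ℤ
      F₀≡  : F 0 ≡ F₀/P * P
      P∤F₀/P : ¬ P ∣ F₀/P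

  open import Algebra.Properties.CommutativeSemigroup ℤ.*-commutativeSemigroup
    using () renaming (xy∙z≈xz∙y to xy*z≡xz*y)

  -- Let m be the least index with P not dividing `f m`. It is at most n, for otherwise P would
  -- divide `c * F n`. As P does not divide `g 0`, coefficient m of the product is `g 0 * f m`
  -- modulo P, hence prime to P; below n this contradicts the divisibility of `F m`, so m = n.
  P∤-scale⇒P∤fₙ : ∀ {F : ℕ → ℤ} {n} {f g : ℕ → ℤ} {c} → IsEisenstein F n → ¬ P ∣ c →
                  (∀ k → (f ⋆ g) k ≡ c * F k) → P ∣ f 0 → ¬ P ∣ f n
  P∤-scale⇒P∤fₙ {F} {n} {f} {g} {c} eis P∤c fg≡cF (divides a f₀≡aP) P∣fn with bottom f (suc n)
    where open IsEisenstein eis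
  ... | inj₁ f≤n = P∤x*y {c} {F n} P∤c P∤Fₙ
        (subst (P ∣_) (trans (⋆-comm g f n) (fg≡cF n)) (P∣f⋆g n (λ i≤n → f≤n (s≤s i≤n))))
    where open IsEisenstein eis
  ... | inj₂ (m , m≤n , f<m , P∤fm) with ℕ.m≤n⇒m<n∨m≡n (ℕ.s≤s⁻¹ m≤n)
  ...   | inj₂ refl = P∤fm P∣fn
  ...   | inj₁ m<n = P∤x*y {g 0} {f m} P∤g₀ P∤fm
          (⋆-bottom {g} {f} 0 m (λ ()) f<m
            (subst (P ∣_) (sym (trans (⋆-comm g f m) (fg≡cF m))) (ℤ.∣n⇒∣m*n c (P∣F< m<n))))
    where
    open IsEisenstein eis
    -- The factor P of `F 0` is already spent on `f 0`: after cancelling it, P dividing `g 0` would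
    -- make P divide `c * F₀/P`.
    P∤g₀ : ¬ P ∣ g 0
    P∤g₀ P∣g₀ = P∤x*y {c} {F₀/P} P∤c P∤F₀/P
      (subst (P ∣_) (ℤ.*-cancelʳ-≡ (a * g 0) (c * F₀/P) P ag₀P≡cF₀/PP) (ℤ.∣n⇒∣m*n a P∣g₀))
      where
      open ≡-Reasoning
      ag₀P≡cF₀/PP : a * g 0 * P ≡ c * F₀/P * P
      ag₀P≡cF₀/PP = begin
        a * g 0 * P     ≡⟨ xy*z≡xz*y a (g 0) P ⟩
        a * P * g 0     ≡⟨ cong (_* g 0) f₀≡aP ⟨
        f 0 * g 0       ≡⟨ fg≡cF 0 ⟩
        c * F 0         ≡⟨ cong (c *_) F₀≡ ⟩
        c * (F₀/P * P)  ≡⟨ ℤ.*-assoc c F₀/P P ⟨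
        c * F₀/P * P    ∎

  -- One step of the descent behind Gauss's lemma: a factor P of the scale is
  -- moved out of f.
  divide : ∀ {F f g : ℕ → ℤ} c M → VanishesFrom M f → (∀ i → P ∣ f i) → (∀ k → (f ⋆ g) k ≡ c * P * F k) →
           ∃ λ f′ → VanishesFrom M f′ × (∀ i → f i ≡ 0ℤ → f′ i ≡ 0ℤ) × (∀ k → (f′ ⋆ g) k ≡ c * F k)
  divide {F} {f} {g} c M f≥M P∣f fg≡cPF = f′ , (λ M≤i → f≡0⇒f′≡0 _ (f≥M M≤i)) , f≡0⇒f′≡0 , f′g≡cF
    where
    open ≡-Reasoning
    f′ : ℕ → ℤ
    f′ i = ℤ.quotient (P∣f i)
    f≡Pf′ : ∀ i → f i ≡ P * f′ i
    f≡Pf′ i = trans (ℤ._∣_.equality (P∣f i)) (ℤ.*-comm (f′ i) P)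
    f≡0⇒f′≡0 : ∀ i → f i ≡ 0ℤ → f′ i ≡ 0ℤ
    f≡0⇒f′≡0 i fᵢ≡0 = ℤ.*-cancelˡ-≡ P (f′ i) 0ℤ
      (trans (sym (f≡Pf′ i)) (trans fᵢ≡0 (sym (ℤ.*-zeroʳ P))))
    f′g≡cF : ∀ k → (f′ ⋆ g) k ≡ c * F k
    f′g≡cF k = ℤ.*-cancelˡ-≡ P ((f′ ⋆ g) k) (c * F k) (begin
      P * (f′ ⋆ g) k               ≡⟨ *-⋆-assoc P f′ g k ⟨
      ((λ i → P * f′ i) ⋆ g) k     ≡⟨ ⋆-cong (λ i → sym (f≡Pf′ i)) (λ _ → refl) k ⟩
      (f ⋆ g) k                    ≡⟨ fg≡cPF k ⟩
      c * P * F k                  ≡⟨ cong (_* F k) (ℤ.*-comm c P) ⟩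
      P * c * F k                  ≡⟨ ℤ.*-assoc P c (F k) ⟩
      P * (c * F k)                ∎)

  -- Induction on the absolute value of c, which drops each time P is divided out. The conclusion is
  -- non-vanishing, not indivisibility by P, because only the former carries over from the divided
  -- factor to the original one.
  eisenstein : ∀ {F : ℕ → ℤ} {n} {f g : ℕ → ℤ} {c} M N → IsEisenstein F n → n ≢ 0 → c ≢ 0ℤ →
               VanishesFrom M f → VanishesFrom N g → (∀ k → (f ⋆ g) k ≡ c * F k) →
               f n ≢ 0ℤ ⊎ g n ≢ 0ℤ
  eisenstein {F} {n} {c = c₀} M₀ N₀ eis n≢0 = go M₀ N₀ (<-wellFounded ℤ.∣ c₀ ∣)
    where
    open IsEisenstein eis
    c′≢0 : ∀ {c} → c * P ≢ 0ℤ → c ≢ 0ℤ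
    c′≢0 cP≢0 refl = cP≢0 refl
    ∣c′∣<∣c′*P∣ : ∀ {c} → c * P ≢ 0ℤ → ℤ.∣ c ∣ < ℤ.∣ c * P ∣
    ∣c′∣<∣c′*P∣ {c} cP≢0 = subst (ℤ.∣ c ∣ <_) (sym (ℤ.abs-* c P))
      (ℕ.m<m*n ℤ.∣ c ∣ p {{ℤ.≢-nonZero (c′≢0 {c} cP≢0)}}
        (ℕ.nonTrivial⇒n>1 p {{prime⇒nonTrivial p-prime}}))
    go : ∀ {f g : ℕ → ℤ} {c} M N → Acc _<_ ℤ.∣ c ∣ → c ≢ 0ℤ →
         VanishesFrom M f → VanishesFrom N g → (∀ k → (f ⋆ g) k ≡ c * F k) →
         f n ≢ 0ℤ ⊎ g n ≢ 0ℤ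
    go {f} {g} {c} M N (acc rec) c≢0 f≥M g≥N fg≡cF with P ℤ.∣? c
    ... | no P∤c =
      [ (λ P∣f₀ → inj₁ λ fₙ≡0 → P∤-scale⇒P∤fₙ {c = c} eis P∤c fg≡cF P∣f₀ (divides 0ℤ fₙ≡0))
      , (λ P∣g₀ → inj₂ λ gₙ≡0 → P∤-scale⇒P∤fₙ {c = c} eis P∤c (λ k → trans (⋆-comm g f k) (fg≡cF k))
                                  P∣g₀ (divides 0ℤ gₙ≡0))
      ]′ (P∣x*y⇒P∣x⊎P∣y (f 0) (g 0)
            -- The constant term counts among the coefficients below n because n is nonzero.
            (subst (P ∣_) (sym (fg≡cF 0)) (ℤ.∣n⇒∣m*n c (P∣F< (ℕ.n≢0⇒n>0 n≢0)))))
    ... | yes (divides c′ refl)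
      with gauss M N f≥M g≥N (λ k → subst (P ∣_) (sym (fg≡cF k)) (ℤ.∣m⇒∣m*n (F k) (divides c′ refl)))
    ...   | inj₁ P∣f =
      let f′ , f′≥M , f≡0⇒f′≡0 , f′g≡c′F = divide {F} c′ M f≥M P∣f fg≡cF
      in map₁ (_∘ f≡0⇒f′≡0 n) (go M N (rec (∣c′∣<∣c′*P∣ {c′} c≢0)) (c′≢0 {c′} c≢0) f′≥M g≥N f′g≡c′F)
    ...   | inj₂ P∣g =
      let g′ , g′≥N , g≡0⇒g′≡0 , g′f≡c′F =
            divide c′ N g≥N P∣g (λ k → trans (⋆-comm g f k) (fg≡cF k))
      in map₂ (_∘ g≡0⇒g′≡0 n) (go M N (rec (∣c′∣<∣c′*P∣ {c′} c≢0)) (c′≢0 {c′} c≢0) f≥M g′≥N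
           (λ k → trans (⋆-comm f g′ k) (g′f≡c′F k)))

-- The embedding of ℤ into ℚ

module ℚ[[X]] = Convolution ℚ.+-*-commutativeRing
open ℚ[[X]] using (_⋆_)

ι : ℤ → ℚ
ι i = i ℚ./ 1

-- `i / 1` is normalised through a gcd and does not reduce for a variable i. In unnormalised
-- fractions the homomorphism laws are plain cross-multiplications, and this equation moves between
-- the two.
toℚᵘ-ι : ∀ i → ℚ.toℚᵘ (ι i) ℚᵘ.≃ mkℚᵘ i 0
toℚᵘ-ι i = ℚ.toℚᵘ-fromℚᵘ (mkℚᵘ i 0)

ι-homo-+ : ∀ i j → ι (i ℤ.+ j) ≡ ι i ℚ.+ ι j
ι-homo-+ i j = ℚ.toℚᵘ-injective (begin
  ℚ.toℚᵘ (ι (i ℤ.+ j))              ≈⟨ toℚᵘ-ι (i ℤ.+ j) ⟩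
  mkℚᵘ (i ℤ.+ j) 0                  ≈⟨ *≡* (cong (ℤ._* 1ℤ) (sym (cong₂ ℤ._+_ (ℤ.*-identityʳ i) (ℤ.*-identityʳ j)))) ⟩
  mkℚᵘ i 0 ℚᵘ.+ mkℚᵘ j 0            ≈⟨ ℚᵘ.+-cong (toℚᵘ-ι i) (toℚᵘ-ι j) ⟨
  ℚ.toℚᵘ (ι i) ℚᵘ.+ ℚ.toℚᵘ (ι j)    ≈⟨ ℚ.toℚᵘ-homo-+ (ι i) (ι j) ⟨
  ℚ.toℚᵘ (ι i ℚ.+ ι j)              ∎)
  where open import Relation.Binary.Reasoning.Setoid ℚᵘ.≃-setoid

ι-homo-* : ∀ i j → ι (i ℤ.* j) ≡ ι i ℚ.* ι j
ι-homo-* i j = ℚ.toℚᵘ-injective (begin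
  ℚ.toℚᵘ (ι (i ℤ.* j))              ≈⟨ toℚᵘ-ι (i ℤ.* j) ⟩
  mkℚᵘ i 0 ℚᵘ.* mkℚᵘ j 0            ≈⟨ ℚᵘ.*-cong (toℚᵘ-ι i) (toℚᵘ-ι j) ⟨
  ℚ.toℚᵘ (ι i) ℚᵘ.* ℚ.toℚᵘ (ι j)    ≈⟨ ℚ.toℚᵘ-homo-* (ι i) (ι j) ⟨
  ℚ.toℚᵘ (ι i ℚ.* ι j)              ∎)
  where open import Relation.Binary.Reasoning.Setoid ℚᵘ.≃-setoid

ι-injective : ∀ {i j} → ι i ≡ ι j → i ≡ j
ι-injective {i} {j} ιi≡ιj with *≡* i*1≡j*1 ← ℚ.fromℚᵘ-injective {mkℚᵘ i 0} {mkℚᵘ j 0} ιi≡ιj =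
  trans (sym (ℤ.*-identityʳ i)) (trans i*1≡j*1 (ℤ.*-identityʳ j))

ι↧q*q≡ι↥q : ∀ q → ι (ℚ.↧ q) ℚ.* q ≡ ι (ℚ.↥ q)
ι↧q*q≡ι↥q q@record{} = ℚ.toℚᵘ-injective (begin
  ℚ.toℚᵘ (ι (ℚ.↧ q) ℚ.* q)           ≈⟨ ℚ.toℚᵘ-homo-* (ι (ℚ.↧ q)) q ⟩
  ℚ.toℚᵘ (ι (ℚ.↧ q)) ℚᵘ.* ℚ.toℚᵘ q   ≈⟨ ℚᵘ.*-congʳ (toℚᵘ-ι (ℚ.↧ q)) ⟩
  mkℚᵘ (ℚ.↧ q) 0 ℚᵘ.* ℚ.toℚᵘ q       ≈⟨ *≡* lemma ⟩
  mkℚᵘ (ℚ.↥ q) 0                     ≈⟨ toℚᵘ-ι (ℚ.↥ q) ⟨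
  ℚ.toℚᵘ (ι (ℚ.↥ q))                 ∎)
  where
  open import Relation.Binary.Reasoning.Setoid ℚᵘ.≃-setoid
  lemma : ℚ.↧ q ℤ.* ℚ.↥ q ℤ.* 1ℤ ≡ ℚ.↥ q ℤ.* + (1 ℕ.* suc (ℚ.denominator-1 q))
  lemma = trans (ℤ.*-identityʳ _) (trans (ℤ.*-comm (ℚ.↧ q) (ℚ.↥ q))
    (cong (λ d → ℚ.↥ q ℤ.* + d) (sym (ℕ.*-identityˡ (suc (ℚ.denominator-1 q))))))

ι-homo-⋆ : ∀ (f g : ℕ → ℤ) n → ι ((f ℤ[[X]].⋆ g) n) ≡ ((ι ∘ f) ⋆ (ι ∘ g)) n
ι-homo-⋆ f g zero    = ι-homo-* (f 0) (g 0)
ι-homo-⋆ f g (suc n) = trans (ι-homo-+ (f 0 ℤ.* g (suc n)) (((f ∘ suc) ℤ[[X]].⋆ g) n))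
  (cong₂ ℚ._+_ (ι-homo-* (f 0) (g (suc n))) (ι-homo-⋆ (f ∘ suc) g n))

-- The ring ℚ[X]

coeff-+ : ∀ f g n → coeff (f +ᵖ g) n ≡ coeff f n ℚ.+ coeff g n
coeff-+ []      g       n       = sym (ℚ.+-identityˡ (coeff g n))
coeff-+ (a ∷ f) []      n       = sym (ℚ.+-identityʳ (coeff (a ∷ f) n))
coeff-+ (a ∷ f) (b ∷ g) zero    = refl
coeff-+ (a ∷ f) (b ∷ g) (suc n) = coeff-+ f g n

coeff-map : ∀ (h : ℚ → ℚ) → h 0ℚ ≡ 0ℚ → ∀ f n → coeff (map h f) n ≡ h (coeff f n)
coeff-map h h0≡0 []      n       = sym h0≡0
coeff-map h h0≡0 (a ∷ f) zero    = refl
coeff-map h h0≡0 (a ∷ f) (suc n) = coeff-map h h0≡0 f n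

coeff-neg : ∀ f n → coeff (-ᵖ f) n ≡ ℚ.- coeff f n
coeff-neg = coeff-map ℚ.-_ refl

-- Through this bridge the multiplicative laws of ℚ[X] are inherited from those of `⋆`.
coeff-* : ∀ f g n → coeff (f *ᵖ g) n ≡ (coeff f ⋆ coeff g) n
coeff-* []      g n    = sym (ℚ[[X]].⋆-zeroˡ (coeff g) (λ _ → refl) n)
coeff-* (a ∷ f) g zero = trans (coeff-+ (map (a ℚ.*_) g) (0ℚ ∷ f *ᵖ g) 0)
  (trans (ℚ.+-identityʳ _) (coeff-map (a ℚ.*_) (ℚ.*-zeroʳ a) g 0))
coeff-* (a ∷ f) g (suc n) = trans (coeff-+ (map (a ℚ.*_) g) (0ℚ ∷ f *ᵖ g) (suc n))
  (cong₂ ℚ._+_ (coeff-map (a ℚ.*_) (ℚ.*-zeroʳ a) g (suc n)) (coeff-* f g n))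

const-*ᵖ : ∀ a g n → coeff ((a ∷ []) *ᵖ g) n ≡ a ℚ.* coeff g n
const-*ᵖ a g zero    = coeff-* (a ∷ []) g 0
const-*ᵖ a g (suc n) = trans (coeff-* (a ∷ []) g (suc n))
  (trans (cong ((a ℚ.* coeff g (suc n)) ℚ.+_) (ℚ[[X]].⋆-zeroˡ (coeff g) (λ _ → refl) n)) (ℚ.+-identityʳ _))

ℚ[X]-commutativeRing : CommutativeRing 0ℓ 0ℓ
ℚ[X]-commutativeRing = record
  { Carrier = ℚ[X]
  ; _≈_ = _≈ᵖ_
  ; _+_ = _+ᵖ_
  ; _*_ = _*ᵖ_
  ; -_  = -ᵖ_
  ; 0#  = []
  ; 1#  = 1ℚ ∷ []
  ; isCommutativeRing = record
    { isRing = record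
      { +-isAbelianGroup = record
        { isGroup = record
          { isMonoid = record
            { isSemigroup = record
              { isMagma = record
                { isEquivalence = record
                  { refl  = λ _ → refl
                  ; sym   = λ f≈g n → sym (f≈g n)
                  ; trans = λ f≈g g≈h n → trans (f≈g n) (g≈h n)
                  }
                ; ∙-cong = λ {f} {f′} {g} {g′} f≈f′ g≈g′ n →
                    trans (coeff-+ f g n) (trans (cong₂ ℚ._+_ (f≈f′ n) (g≈g′ n)) (sym (coeff-+ f′ g′ n)))
                }
              ; assoc = λ f g h n → begin
                  coeff (f +ᵖ g +ᵖ h) n                     ≡⟨ coeff-+ (f +ᵖ g) h n ⟩
                  coeff (f +ᵖ g) n ℚ.+ coeff h n            ≡⟨ cong (ℚ._+ coeff h n) (coeff-+ f g n) ⟩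
                  coeff f n ℚ.+ coeff g n ℚ.+ coeff h n     ≡⟨ ℚ.+-assoc (coeff f n) (coeff g n) (coeff h n) ⟩
                  coeff f n ℚ.+ (coeff g n ℚ.+ coeff h n)   ≡⟨ cong (coeff f n ℚ.+_) (coeff-+ g h n) ⟨
                  coeff f n ℚ.+ coeff (g +ᵖ h) n            ≡⟨ coeff-+ f (g +ᵖ h) n ⟨
                  coeff (f +ᵖ (g +ᵖ h)) n                   ∎
              }
            ; identity = (λ f n → refl) , λ f n → trans (coeff-+ f [] n) (ℚ.+-identityʳ (coeff f n))
            }
          ; inverse =
              (λ f n → trans (coeff-+ (-ᵖ f) f n)
                (trans (cong (ℚ._+ coeff f n) (coeff-neg f n)) (ℚ.+-inverseˡ (coeff f n)))) ,
              (λ f n → trans (coeff-+ f (-ᵖ f) n)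
                (trans (cong (coeff f n ℚ.+_) (coeff-neg f n)) (ℚ.+-inverseʳ (coeff f n))))
          ; ⁻¹-cong = λ {f} {g} f≈g n →
              trans (coeff-neg f n) (trans (cong ℚ.-_ (f≈g n)) (sym (coeff-neg g n)))
          }
        ; comm = λ f g n →
            trans (coeff-+ f g n) (trans (ℚ.+-comm (coeff f n) (coeff g n)) (sym (coeff-+ g f n)))
        }
      ; *-cong = λ {f} {f′} {g} {g′} f≈f′ g≈g′ n →
          trans (coeff-* f g n) (trans (ℚ[[X]].⋆-cong f≈f′ g≈g′ n) (sym (coeff-* f′ g′ n)))
      ; *-assoc = λ f g h n → begin
          coeff (f *ᵖ g *ᵖ h) n               ≡⟨ coeff-* (f *ᵖ g) h n ⟩
          (coeff (f *ᵖ g) ⋆ coeff h) n        ≡⟨ ℚ[[X]].⋆-cong (coeff-* f g) (λ _ → refl) n ⟩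
          ((coeff f ⋆ coeff g) ⋆ coeff h) n   ≡⟨ ℚ[[X]].⋆-assoc (coeff f) (coeff g) (coeff h) n ⟩
          (coeff f ⋆ (coeff g ⋆ coeff h)) n   ≡⟨ ℚ[[X]].⋆-cong {coeff f} (λ _ → refl) (coeff-* g h) n ⟨
          (coeff f ⋆ coeff (g *ᵖ h)) n        ≡⟨ coeff-* f (g *ᵖ h) n ⟨
          coeff (f *ᵖ (g *ᵖ h)) n             ∎
      ; *-identity = *-identityˡ , λ f n → trans (*-comm f (1ℚ ∷ []) n) (*-identityˡ f n)
      ; distrib =
          (λ f g h n → trans (*-comm f (g +ᵖ h) n) (trans (*-distribʳ f g h n)
            (trans (coeff-+ (g *ᵖ f) (h *ᵖ f) n) (trans (cong₂ ℚ._+_ (*-comm g f n) (*-comm h f n))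
              (sym (coeff-+ (f *ᵖ g) (f *ᵖ h) n)))))) ,
          *-distribʳ
      }
    ; *-comm = *-comm
    }
  }
  where
  open ≡-Reasoning
  *-comm : ∀ f g → f *ᵖ g ≈ᵖ g *ᵖ f
  *-comm f g n = trans (coeff-* f g n) (trans (ℚ[[X]].⋆-comm (coeff f) (coeff g) n) (sym (coeff-* g f n)))
  *-identityˡ : ∀ f → (1ℚ ∷ []) *ᵖ f ≈ᵖ f
  *-identityˡ f n = trans (const-*ᵖ 1ℚ f n) (ℚ.*-identityˡ (coeff f n))
  *-distribʳ : ∀ h f g → (f +ᵖ g) *ᵖ h ≈ᵖ f *ᵖ h +ᵖ g *ᵖ h
  *-distribʳ h f g n = begin
    coeff ((f +ᵖ g) *ᵖ h) n                               ≡⟨ coeff-* (f +ᵖ g) h n ⟩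
    (coeff (f +ᵖ g) ⋆ coeff h) n                          ≡⟨ ℚ[[X]].⋆-cong (coeff-+ f g) (λ _ → refl) n ⟩
    ((λ k → coeff f k ℚ.+ coeff g k) ⋆ coeff h) n         ≡⟨ ℚ[[X]].⋆-distribʳ (coeff h) (coeff f) (coeff g) n ⟩
    (coeff f ⋆ coeff h) n ℚ.+ (coeff g ⋆ coeff h) n       ≡⟨ cong₂ ℚ._+_ (coeff-* f h n) (coeff-* g h n) ⟨
    coeff (f *ᵖ h) n ℚ.+ coeff (g *ᵖ h) n                 ≡⟨ coeff-+ (f *ᵖ h) (g *ᵖ h) n ⟨
    coeff (f *ᵖ h +ᵖ g *ᵖ h) n                            ∎

-- Factorisations in ℚ[X]

p*q≡0⇒q≡0 : ∀ p q → p ≢ 0ℚ → p ℚ.* q ≡ 0ℚ → q ≡ 0ℚ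
p*q≡0⇒q≡0 p q p≢0 pq≡0 = begin
  q                   ≡⟨ ℚ.*-identityˡ q ⟨
  1ℚ ℚ.* q            ≡⟨ cong (ℚ._* q) (ℚ.*-inverseˡ p) ⟨
  ℚ.1/ p ℚ.* p ℚ.* q  ≡⟨ ℚ.*-assoc (ℚ.1/ p) p q ⟩
  ℚ.1/ p ℚ.* (p ℚ.* q) ≡⟨ cong (ℚ.1/ p ℚ.*_) pq≡0 ⟩
  ℚ.1/ p ℚ.* 0ℚ       ≡⟨ ℚ.*-zeroʳ (ℚ.1/ p) ⟩
  0ℚ                  ∎
  where
  open ≡-Reasoning
  instance _ = ℚ.≢-nonZero p≢0

IsDegree : ℚ[X] → ℕ → Set
IsDegree f d = coeff f d ≢ 0ℚ × (∀ {i} → d < i → coeff f i ≡ 0ℚ)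

degree : ∀ f → f ≈ᵖ [] ⊎ ∃ (IsDegree f)
degree [] = inj₁ λ _ → refl
degree (a ∷ f) with degree f | a ℚ.≟ 0ℚ
... | inj₂ (d , f_d≢0 , f>d) | _ = inj₂ (suc d , f_d≢0 , λ { (s≤s d<i) → f>d d<i })
... | inj₁ f≈0 | no a≢0 = inj₂ (0 , a≢0 , λ { (s≤s _) → f≈0 _ })
... | inj₁ f≈0 | yes a≡0 = inj₁ λ { zero → a≡0 ; (suc n) → f≈0 n }

degree≥ : ∀ f {m} → coeff f m ≢ 0ℚ → ∃ λ d → m ≤ d × IsDegree f d
degree≥ f {m} f_m≢0 with degree f
... | inj₁ f≈0 = contradiction (f≈0 m) f_m≢0
... | inj₂ (d , f_d≢0 , f>d) with m ℕ.≤? d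
...   | yes m≤d = d , m≤d , f_d≢0 , f>d
...   | no m≰d = contradiction (f>d (ℕ.≰⇒> m≰d)) f_m≢0

-- The true degrees d ≥ m and e ≥ k are found first, and the leading coefficients multiply to a
-- nonzero number. Any nonzero coefficients may be supplied, so the caller never has to know a
-- degree.
degree-* : ∀ f g {m k} → coeff f m ≢ 0ℚ → coeff g k ≢ 0ℚ →
           ∃ λ l → m ℕ.+ k ≤ l × coeff (f *ᵖ g) l ≢ 0ℚ
degree-* f g f_m≢0 g_k≢0 with degree≥ f f_m≢0 | degree≥ g g_k≢0
... | d , m≤d , f_d≢0 , f>d | e , k≤e , g_e≢0 , g>e =
  d ℕ.+ e , ℕ.+-mono-≤ m≤d k≤e , λ fg≡0 → g_e≢0 (p*q≡0⇒q≡0 (coeff f d) (coeff g e) f_d≢0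
    (trans (sym (ℚ[[X]].⋆-top {coeff f} {coeff g} d e f>d g>e)) (trans (sym (coeff-* f g (d ℕ.+ e))) fg≡0)))

constant∣1 : ∀ f → coeff f 0 ≢ 0ℚ → (∀ j → coeff f (suc j) ≡ 0ℚ) → f ∣ᵖ (1ℚ ∷ [])
constant∣1 f f₀≢0 f>0 = record { quotient = (ℚ.1/ coeff f 0) ∷ [] ; equality = λ
  { zero    → trans (const-*ᵖ (ℚ.1/ coeff f 0) f 0) (ℚ.*-inverseˡ (coeff f 0))
  ; (suc j) → trans (const-*ᵖ (ℚ.1/ coeff f 0) f (suc j))
                (trans (cong ((ℚ.1/ coeff f 0) ℚ.*_) (f>0 j)) (ℚ.*-zeroʳ (ℚ.1/ coeff f 0)))
  } }
  where instance _ = ℚ.≢-nonZero f₀≢0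

clearDenominators : ∀ x → ∃₂ λ (d : ℤ) (f : ℕ → ℤ) → d ≢ 0ℤ ×
  (∀ {i} → length x ≤ i → f i ≡ 0ℤ) × (∀ i → ι (f i) ≡ ι d ℚ.* coeff x i)
clearDenominators [] = 1ℤ , (λ _ → 0ℤ) , (λ ()) , (λ _ → refl) , (λ _ → refl)
clearDenominators (a@record{} ∷ x) with d , f , d≢0 , f≥ , f≡dx ← clearDenominators x =
  ℚ.↧ a ℤ.* d , f′ , ↧ad≢0 , f′≥ , f′≡
  where
  open ≡-Reasoning
  f′ : ℕ → ℤ
  f′ zero    = d ℤ.* ℚ.↥ a
  f′ (suc i) = ℚ.↧ a ℤ.* f i
  ↧ad≢0 : ℚ.↧ a ℤ.* d ≢ 0ℤ
  ↧ad≢0 ↧ad≡0 = [ (λ ()) , d≢0 ]′ (ℤ.i*j≡0⇒i≡0∨j≡0 (ℚ.↧ a) ↧ad≡0)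
  f′≥ : ∀ {i} → suc (length x) ≤ i → f′ i ≡ 0ℤ
  f′≥ (s≤s l≤i) = trans (cong (ℚ.↧ a ℤ.*_) (f≥ l≤i)) (ℤ.*-zeroʳ (ℚ.↧ a))
  f′≡ : ∀ i → ι (f′ i) ≡ ι (ℚ.↧ a ℤ.* d) ℚ.* coeff (a ∷ x) i
  f′≡ zero = begin
    ι (d ℤ.* ℚ.↥ a)             ≡⟨ ι-homo-* d (ℚ.↥ a) ⟩
    ι d ℚ.* ι (ℚ.↥ a)           ≡⟨ cong (ι d ℚ.*_) (ι↧q*q≡ι↥q a) ⟨
    ι d ℚ.* (ι (ℚ.↧ a) ℚ.* a)   ≡⟨ ℚ.*-assoc (ι d) (ι (ℚ.↧ a)) a ⟨
    ι d ℚ.* ι (ℚ.↧ a) ℚ.* a     ≡⟨ cong (ℚ._* a) (ι-homo-* d (ℚ.↧ a)) ⟨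
    ι (d ℤ.* ℚ.↧ a) ℚ.* a       ≡⟨ cong (λ e → ι e ℚ.* a) (ℤ.*-comm d (ℚ.↧ a)) ⟩
    ι (ℚ.↧ a ℤ.* d) ℚ.* a       ∎
  f′≡ (suc i) = begin
    ι (ℚ.↧ a ℤ.* f i)                     ≡⟨ ι-homo-* (ℚ.↧ a) (f i) ⟩
    ι (ℚ.↧ a) ℚ.* ι (f i)                 ≡⟨ cong (ι (ℚ.↧ a) ℚ.*_) (f≡dx i) ⟩
    ι (ℚ.↧ a) ℚ.* (ι d ℚ.* coeff x i)     ≡⟨ ℚ.*-assoc (ι (ℚ.↧ a)) (ι d) (coeff x i) ⟨
    ι (ℚ.↧ a) ℚ.* ι d ℚ.* coeff x i       ≡⟨ cong (ℚ._* coeff x i) (ι-homo-* (ℚ.↧ a) d) ⟨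
    ι (ℚ.↧ a ℤ.* d) ℚ.* coeff x i         ∎

-- Eisenstein's criterion over ℚ

module _ {p : ℕ} (p-prime : Prime p) where

  open Eisenstein p p-prime

  eisenstein⇒irreducible : ∀ {F n} r → IsEisenstein F n → n ≢ 0 → (∀ {i} → n < i → F i ≡ 0ℤ) →
                           (∀ i → coeff r i ≡ ι (F i)) → Irreducible r
  eisenstein⇒irreducible {F} {n} r eis n≢0 F>n r≡F = record { p∤1 = r∤1 ; split-∣1 = split }
    where
    open IsEisenstein eis
    open ≡-Reasoning

    rₙ≢0 : coeff r n ≢ 0ℚ
    rₙ≢0 rₙ≡0 = P∤Fₙ (divides 0ℤ (ι-injective (trans (sym (r≡F n)) rₙ≡0)))

    r∤1 : ¬ r ∣ᵖ (1ℚ ∷ [])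
    r∤1 record { quotient = q ; equality = qr≈1 } with degree-* q r {0} q₀≢0 rₙ≢0
      where
      q₀≢0 : coeff q 0 ≢ 0ℚ
      q₀≢0 q₀≡0 = contradiction
        (trans (sym (qr≈1 0)) (trans (coeff-* q r 0)
          (trans (cong (ℚ._* coeff r 0) q₀≡0) (ℚ.*-zeroˡ (coeff r 0)))))
        λ ()
    ... | zero  , n≤0 , _       = n≢0 (ℕ.n≤0⇒n≡0 n≤0)
    ... | suc l , _   , qr_l≢0 = qr_l≢0 (qr≈1 (suc l))

    -- Since x reaches degree n, a non-constant term of y would push the product beyond n, where `F`
    -- vanishes. The constant left over is nonzero because coefficient n of r is.
    cofactor∣1 : ∀ x y → r ≈ᵖ x *ᵖ y → coeff x n ≢ 0ℚ → y ∣ᵖ (1ℚ ∷ [])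
    cofactor∣1 x y r≈xy xₙ≢0 = constant∣1 y y₀≢0 y>0
      where
      y>0 : ∀ j → coeff y (suc j) ≡ 0ℚ
      y>0 j with coeff y (suc j) ℚ.≟ 0ℚ
      ... | yes yⱼ≡0 = yⱼ≡0
      ... | no yⱼ≢0 with l , n+j≤l , xy_l≢0 ← degree-* x y xₙ≢0 yⱼ≢0 =
        contradiction (trans (sym (r≈xy l)) (trans (r≡F l) (cong ι (F>n n<l)))) xy_l≢0
        where
        n<l : n < l
        n<l = ℕ.≤-trans (ℕ.m<m+n n z<s) n+j≤l
      y₀≢0 : coeff y 0 ≢ 0ℚ
      y₀≢0 y₀≡0 = rₙ≢0 (trans (r≈xy n) (trans (coeff-* x y n)
        (trans (ℚ[[X]].⋆-comm (coeff x) (coeff y) n)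
          (ℚ[[X]].⋆-zeroˡ (coeff x) (λ { zero → y₀≡0 ; (suc j) → y>0 j }) n))))

    split : ∀ {x y} → r ≈ᵖ x *ᵖ y → x ∣ᵖ (1ℚ ∷ []) ⊎ y ∣ᵖ (1ℚ ∷ [])
    split {x} {y} r≈xy
      with d , f , d≢0 , f≥ , f≡dx ← clearDenominators x
         | e , g , e≢0 , g≥ , g≡ey ← clearDenominators y
      with eisenstein {F} {n} {f} {g} {d ℤ.* e} (length x) (length y) eis n≢0 de≢0 f≥ g≥ fg≡deF
      where
      de≢0 : d ℤ.* e ≢ 0ℤ
      de≢0 de≡0 = [ d≢0 , e≢0 ]′ (ℤ.i*j≡0⇒i≡0∨j≡0 d de≡0)
      fg≡deF : ∀ k → (f ℤ[[X]].⋆ g) k ≡ d ℤ.* e ℤ.* F k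
      fg≡deF k = ι-injective (begin
        ι ((f ℤ[[X]].⋆ g) k)
          ≡⟨ ι-homo-⋆ f g k ⟩
        ((ι ∘ f) ⋆ (ι ∘ g)) k
          ≡⟨ ℚ[[X]].⋆-cong f≡dx g≡ey k ⟩
        ((λ i → ι d ℚ.* coeff x i) ⋆ (λ j → ι e ℚ.* coeff y j)) k
          ≡⟨ ℚ[[X]].*-⋆-assoc (ι d) (coeff x) (λ j → ι e ℚ.* coeff y j) k ⟩
        ι d ℚ.* (coeff x ⋆ (λ j → ι e ℚ.* coeff y j)) k
          ≡⟨ cong (ι d ℚ.*_) (ℚ[[X]].⋆-comm (coeff x) (λ j → ι e ℚ.* coeff y j) k) ⟩
        ι d ℚ.* ((λ j → ι e ℚ.* coeff y j) ⋆ coeff x) k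
          ≡⟨ cong (ι d ℚ.*_) (ℚ[[X]].*-⋆-assoc (ι e) (coeff y) (coeff x) k) ⟩
        ι d ℚ.* (ι e ℚ.* (coeff y ⋆ coeff x) k)
          ≡⟨ ℚ.*-assoc (ι d) (ι e) ((coeff y ⋆ coeff x) k) ⟨
        ι d ℚ.* ι e ℚ.* (coeff y ⋆ coeff x) k
          ≡⟨ cong₂ ℚ._*_ (ι-homo-* d e) (trans (sym (r≡F k))
               (trans (r≈xy k) (trans (coeff-* x y k) (ℚ[[X]].⋆-comm (coeff x) (coeff y) k)))) ⟨
        ι (d ℤ.* e) ℚ.* ι (F k)
          ≡⟨ ι-homo-* (d ℤ.* e) (F k) ⟨
        ι (d ℤ.* e ℤ.* F k)
          ∎)
    ... | inj₁ fₙ≢0 = inj₂ (cofactor∣1 x y r≈xy λ xₙ≡0 → fₙ≢0 (ι-injective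
            (trans (f≡dx n) (trans (cong (ι d ℚ.*_) xₙ≡0) (ℚ.*-zeroʳ (ι d))))))
    ... | inj₂ gₙ≢0 = inj₁ (cofactor∣1 y x
            (λ k → trans (r≈xy k) (CommutativeRing.*-comm ℚ[X]-commutativeRing x y k))
            λ yₙ≡0 → gₙ≢0 (ι-injective
              (trans (g≡ey n) (trans (cong (ι e ℚ.*_) yₙ≡0) (ℚ.*-zeroʳ (ι e))))))

-- The sequence W and its coefficients

-- pascal i j is the binomial coefficient C(i + j, j).
pascal : ℕ → ℕ → ℕ
pascal zero    j       = 1
pascal (suc i) zero    = 1
pascal (suc i) (suc j) = pascal i (suc j) ℕ.+ pascal (suc i) j

pascal-zeroʳ : ∀ i → pascal i 0 ≡ 1
pascal-zeroʳ zero    = refl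
pascal-zeroʳ (suc i) = refl

-- The two absorption identities are proved together. Each inductive step uses both at the smaller
-- index to exchange `suc i * pascal (suc i) j` and `suc j * pascal i (suc j)`, after which the
-- summands share a factor.
pascal-sucˡ : ∀ i j → suc i ℕ.* pascal (suc i) j ≡ suc (i ℕ.+ j) ℕ.* pascal i j
pascal-sucʳ : ∀ i j → suc j ℕ.* pascal i (suc j) ≡ suc (i ℕ.+ j) ℕ.* pascal i j

pascal-sucˡ i zero = cong₂ ℕ._*_ (cong suc (sym (ℕ.+-identityʳ i))) (sym (pascal-zeroʳ i))
pascal-sucˡ i (suc j) = begin
  suc i ℕ.* (pascal i (suc j) ℕ.+ pascal (suc i) j)
    ≡⟨ ℕ.*-distribˡ-+ (suc i) (pascal i (suc j)) (pascal (suc i) j) ⟩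
  suc i ℕ.* pascal i (suc j) ℕ.+ suc i ℕ.* pascal (suc i) j
    ≡⟨ cong (suc i ℕ.* pascal i (suc j) ℕ.+_) (trans (pascal-sucˡ i j) (sym (pascal-sucʳ i j))) ⟩
  suc i ℕ.* pascal i (suc j) ℕ.+ suc j ℕ.* pascal i (suc j)
    ≡⟨ ℕ.*-distribʳ-+ (pascal i (suc j)) (suc i) (suc j) ⟨
  suc (i ℕ.+ suc j) ℕ.* pascal i (suc j)
    ∎
  where open ≡-Reasoning
pascal-sucʳ zero    j = refl
pascal-sucʳ (suc i) j = begin
  suc j ℕ.* (pascal i (suc j) ℕ.+ pascal (suc i) j)
    ≡⟨ ℕ.*-distribˡ-+ (suc j) (pascal i (suc j)) (pascal (suc i) j) ⟩
  suc j ℕ.* pascal i (suc j) ℕ.+ suc j ℕ.* pascal (suc i) j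
    ≡⟨ cong (ℕ._+ suc j ℕ.* pascal (suc i) j) (trans (pascal-sucʳ i j) (sym (pascal-sucˡ i j))) ⟩
  suc i ℕ.* pascal (suc i) j ℕ.+ suc j ℕ.* pascal (suc i) j
    ≡⟨ ℕ.*-distribʳ-+ (pascal (suc i) j) (suc i) (suc j) ⟨
  (suc i ℕ.+ suc j) ℕ.* pascal (suc i) j
    ≡⟨ cong (λ n → suc n ℕ.* pascal (suc i) j) (ℕ.+-suc i j) ⟩
  suc (suc i ℕ.+ j) ℕ.* pascal (suc i) j
    ∎
  where open ≡-Reasoning

-- lucasTriangle i j is the coefficient of X^i b^j in W b (i + 2j).
lucasTriangle : ℕ → ℕ → ℕ
lucasTriangle zero    j       = 2
lucasTriangle (suc i) zero    = 1
lucasTriangle (suc i) (suc j) = lucasTriangle i (suc j) ℕ.+ lucasTriangle (suc i) j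

-- Both sides obey Pascal's recursion with the same boundary values.
lucasTriangle-suc : ∀ i j → lucasTriangle i (suc j) ≡ pascal i (suc j) ℕ.+ pascal i j
lucasTriangle-suc zero    j       = refl
lucasTriangle-suc (suc i) zero
  rewrite lucasTriangle-suc i zero | pascal-zeroʳ i = refl
lucasTriangle-suc (suc i) (suc j)
  rewrite lucasTriangle-suc i (suc j) | lucasTriangle-suc (suc i) j =
  lemma (pascal i (suc (suc j))) (pascal i (suc j)) (pascal (suc i) j)
  where
  lemma : ∀ x y z → x ℕ.+ y ℕ.+ (y ℕ.+ z ℕ.+ z) ≡ x ℕ.+ (y ℕ.+ z) ℕ.+ (y ℕ.+ z)
  lemma = solve-∀

-- Defined by recursion so that an index `double (suc j) ℕ.+ i` unfolds to two successors and the
-- recurrence of `w` computes on it.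
double : ℕ → ℕ
double zero    = 0
double (suc n) = suc (suc (double n))

double≡ : ∀ n → double n ≡ n ℕ.+ n
double≡ zero    = refl
double≡ (suc n) = cong suc (trans (cong suc (double≡ n)) (sym (ℕ.+-suc n n)))

-- The closed form of the coefficients cleared of its denominator, with j shifted by one. The factor
-- on the right is the index i + 2(j + 1) of the polynomial, which will be p.
*-lucasTriangle : ∀ i j →
  suc (i ℕ.+ j) ℕ.* lucasTriangle i (suc j) ≡ (double (suc j) ℕ.+ i) ℕ.* pascal i (suc j)
*-lucasTriangle i j rewrite double≡ j = begin
  suc (i ℕ.+ j) ℕ.* lucasTriangle i (suc j)
    ≡⟨ cong (suc (i ℕ.+ j) ℕ.*_) (lucasTriangle-suc i j) ⟩
  suc (i ℕ.+ j) ℕ.* (pascal i (suc j) ℕ.+ pascal i j)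
    ≡⟨ ℕ.*-distribˡ-+ (suc (i ℕ.+ j)) (pascal i (suc j)) (pascal i j) ⟩
  suc (i ℕ.+ j) ℕ.* pascal i (suc j) ℕ.+ suc (i ℕ.+ j) ℕ.* pascal i j
    ≡⟨ cong (suc (i ℕ.+ j) ℕ.* pascal i (suc j) ℕ.+_) (pascal-sucʳ i j) ⟨
  suc (i ℕ.+ j) ℕ.* pascal i (suc j) ℕ.+ suc j ℕ.* pascal i (suc j)
    ≡⟨ lemma i j (pascal i (suc j)) ⟩
  (suc (suc (j ℕ.+ j)) ℕ.+ i) ℕ.* pascal i (suc j)
    ∎
  where
  open ≡-Reasoning
  lemma : ∀ i j x → suc (i ℕ.+ j) ℕ.* x ℕ.+ suc j ℕ.* x ≡ (suc (suc (j ℕ.+ j)) ℕ.+ i) ℕ.* x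
  lemma = solve-∀

lucasTriangle-1 : ∀ j → lucasTriangle 1 j ≡ suc (double j)
lucasTriangle-1 zero    = refl
lucasTriangle-1 (suc j) = cong (2 ℕ.+_) (lucasTriangle-1 j)

-- By Euclid's lemma p divides one factor on the left of `*-lucasTriangle`, and `suc (i + j)` is
-- positive and smaller than p. The shift to `suc j` leaves out the leading coefficient.
p∣lucasTriangle : ∀ {p} i j → Prime p → p ≡ double (suc j) ℕ.+ i → p ℕ.∣ lucasTriangle i (suc j)
p∣lucasTriangle {p} i j p-prime refl
  with euclidsLemma (suc (i ℕ.+ j)) (lucasTriangle i (suc j)) p-prime
         (subst (p ℕ.∣_) (sym (*-lucasTriangle i j)) (ℕ.m∣m*n (pascal i (suc j))))
... | inj₂ p∣A = p∣A
... | inj₁ p∣1+i+j = contradiction p∣1+i+j (ℕ.>⇒∤ 1+i+j<p)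
  where
  1+i+j<p : suc (i ℕ.+ j) < p
  1+i+j<p rewrite double≡ j | ℕ.+-comm i j = s≤s (s≤s (ℕ.+-monoˡ-≤ i (ℕ.m≤m+n j j)))

coeff-X* : ∀ f n → coeff (X *ᵖ f) n ≡ coeff (0ℚ ∷ f) n
coeff-X* f zero    = trans (coeff-* X f 0) (ℚ.*-zeroˡ (coeff f 0))
coeff-X* f (suc n) = begin
  coeff (X *ᵖ f) (suc n)                                      ≡⟨ coeff-* X f (suc n) ⟩
  0ℚ ℚ.* coeff f (suc n) ℚ.+ (coeff (1ℚ ∷ []) ⋆ coeff f) n    ≡⟨ cong₂ ℚ._+_ (ℚ.*-zeroˡ (coeff f (suc n)))
                                                                    (sym (coeff-* (1ℚ ∷ []) f n)) ⟩
  0ℚ ℚ.+ coeff ((1ℚ ∷ []) *ᵖ f) n                             ≡⟨ ℚ.+-identityˡ _ ⟩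
  coeff ((1ℚ ∷ []) *ᵖ f) n                                    ≡⟨ const-*ᵖ 1ℚ f n ⟩
  1ℚ ℚ.* coeff f n                                            ≡⟨ ℚ.*-identityˡ (coeff f n) ⟩
  coeff f n                                                   ∎
  where open ≡-Reasoning

module _ (b : ℤ) where

  W : ℕ → ℚ[X]
  W 0             = const (+ 2)
  W 1             = X
  W (suc (suc n)) = X *ᵖ W (suc n) +ᵖ const b *ᵖ W n

  w : ℕ → ℕ → ℤ
  w 0             0             = + 2
  w 0             (suc i)       = 0ℤ
  w 1             1             = 1ℤ
  w 1             _             = 0ℤ
  w (suc (suc n)) 0             = b ℤ.* w n 0
  w (suc (suc n)) (suc i)       = w (suc n) i ℤ.+ b ℤ.* w n (suc i)

  coeff-W : ∀ n i → coeff (W n) i ≡ ι (w n i)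
  coeff-W 0 0 = refl
  coeff-W 0 (suc i) = refl
  coeff-W 1 0 = refl
  coeff-W 1 1 = refl
  coeff-W 1 (suc (suc i)) = refl
  coeff-W (suc (suc n)) i = trans (coeff-+ (X *ᵖ W (suc n)) (const b *ᵖ W n) i)
    (trans (cong₂ ℚ._+_ (coeff-X* (W (suc n)) i)
             (trans (const-*ᵖ (ι b) (W n) i)
               (trans (cong (ι b ℚ.*_) (coeff-W n i)) (sym (ι-homo-* b (w n i))))))
      (step i))
    where
    step : ∀ i → coeff (0ℚ ∷ W (suc n)) i ℚ.+ ι (b ℤ.* w n i) ≡ ι (w (suc (suc n)) i)
    step zero    = ℚ.+-identityˡ _
    step (suc i) = trans (cong (ℚ._+ ι (b ℤ.* w n (suc i))) (coeff-W (suc n) i))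
      (sym (ι-homo-+ (w (suc n) i) (b ℤ.* w n (suc i))))

  +-*-zero : ∀ {x y} → x ≡ 0ℤ → y ≡ 0ℤ → x ℤ.+ b ℤ.* y ≡ 0ℤ
  +-*-zero refl refl = trans (ℤ.+-identityˡ (b ℤ.* 0ℤ)) (ℤ.*-zeroʳ b)

  w-above : ∀ {n i} → n < i → w n i ≡ 0ℤ
  w-above {0}           {suc i}       _         = refl
  w-above {1}           {suc (suc i)} _         = refl
  w-above {1}           {1}           (s≤s ())
  w-above {suc (suc n)} {suc i}       (s≤s n<i) =
    +-*-zero (w-above n<i) (w-above (ℕ.m<n⇒m<1+n (ℕ.<-trans ℕ.≤-refl n<i)))

  w-diagonal : ∀ n → w (suc n) (suc n) ≡ 1ℤ
  w-diagonal zero    = refl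
  w-diagonal (suc n) = trans
    (cong₂ (λ x y → x ℤ.+ b ℤ.* y) (w-diagonal n) (w-above {n} (ℕ.m<n⇒m<1+n ℕ.≤-refl)))
    (cong (ℤ._+_ 1ℤ) (ℤ.*-zeroʳ b))

  -- W n contains only powers of X with the parity of n.
  w-odd : ∀ j i → w (suc (double j) ℕ.+ i) i ≡ 0ℤ
  w-odd zero    zero    = refl
  w-odd zero    (suc i) = +-*-zero (w-odd zero i) (w-above {i} ℕ.≤-refl)
  w-odd (suc j) zero    = trans (cong (b ℤ.*_) (w-odd j 0)) (ℤ.*-zeroʳ b)
  w-odd (suc j) (suc i) = +-*-zero
    (subst (λ n → w n i ≡ 0ℤ) (cong (suc ∘ suc) (sym (ℕ.+-suc (double j) i))) (w-odd (suc j) i))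
    (w-odd j (suc i))

  -- In the coordinates n = i + 2j, the term X W lowers i and the term b W lowers j at the cost of a
  -- factor b. This is the recursion of `lucasTriangle`.
  w-even : ∀ j i → w (double j ℕ.+ i) i ≡ + lucasTriangle i j ℤ.* b ℤ.^ j
  w-even zero    zero    = refl
  w-even zero    (suc i) = w-diagonal i
  w-even (suc j) zero    = trans (cong (b ℤ.*_) (w-even j 0)) (x*[y*z]≡y*[x*z] b (+ 2) (b ℤ.^ j))
    where open import Algebra.Properties.CommutativeSemigroup ℤ.*-commutativeSemigroup
            using () renaming (x∙yz≈y∙xz to x*[y*z]≡y*[x*z])
  w-even (suc j) (suc i) = begin
    w (suc (double j ℕ.+ suc i)) i ℤ.+ b ℤ.* w (double j ℕ.+ suc i) (suc i)
      ≡⟨ cong₂ (λ x y → x ℤ.+ b ℤ.* y)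
           (trans (cong (λ n → w (suc n) i) (ℕ.+-suc (double j) i)) (w-even (suc j) i)) (w-even j (suc i)) ⟩
    + x ℤ.* b ℤ.^ suc j ℤ.+ b ℤ.* (+ y ℤ.* b ℤ.^ j)
      ≡⟨ cong (ℤ._+_ (+ x ℤ.* b ℤ.^ suc j)) (x*[y*z]≡y*[x*z] b (+ y) (b ℤ.^ j)) ⟩
    + x ℤ.* b ℤ.^ suc j ℤ.+ + y ℤ.* b ℤ.^ suc j
      ≡⟨ ℤ.*-distribʳ-+ (b ℤ.^ suc j) (+ x) (+ y) ⟨
    + (x ℕ.+ y) ℤ.* b ℤ.^ suc j
      ∎
    where
    open ≡-Reasoning
    open import Algebra.Properties.CommutativeSemigroup ℤ.*-commutativeSemigroup
      using () renaming (x∙yz≈y∙xz to x*[y*z]≡y*[x*z])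
    x = lucasTriangle i (suc j)
    y = lucasTriangle (suc i) j

-- Odd prime indices: W_p / X is an Eisenstein polynomial

data Parity : ℕ → Set where
  even : ∀ j → Parity (double j)
  odd  : ∀ j → Parity (suc (double j))

parity : ∀ n → Parity n
parity zero = even zero
parity (suc n) with parity n
... | even j = odd j
... | odd  j = even (suc j)

module _ {p : ℕ} (p-prime : Prime p) (p>2 : p > 2) where

  open Eisenstein p p-prime

  -- The form `double k + 1` is the index at which `w-even b k 1` gives the coefficient of X.
  p-odd : ∃ λ k → p ≡ double k ℕ.+ 1
  p-odd with parity p
  ... | odd k = k , ℕ.+-comm 1 (double k)
  ... | even k with prime⇒irreducible p-prime (ℕ.divides k (trans (double≡ k) (lemma k)))
    where
    lemma : ∀ k → k ℕ.+ k ≡ k ℕ.* 2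
    lemma = solve-∀
  ...   | inj₂ 2≡p = contradiction 2≡p (ℕ.<⇒≢ p>2)

  P∤1 : ¬ P ∣ 1ℤ
  P∤1 P∣1 = ℕ.>⇒∤ (ℕ.<-trans ℕ.≤-refl p>2) (ℤ.∣⇒∣ᵤ P∣1)

  P∤^ : ∀ {b} k → ¬ P ∣ b → ¬ P ∣ b ℤ.^ k
  P∤^         zero    P∤b = P∤1
  P∤^ {b = b} (suc k) P∤b = P∤x*y {b} {b ℤ.^ k} P∤b (P∤^ k P∤b)

  P∣w : ∀ b i → i < p → P ∣ w b p i
  P∣w b i i<p with d , i+d≡p ← ℕ.m≤n⇒∃[o]m+o≡n (ℕ.<⇒≤ i<p)
                 with p≡d+i ← trans (sym i+d≡p) (ℕ.+-comm i d)
                 with parity d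
  ... | even zero = contradiction (sym p≡d+i) (ℕ.<⇒≢ i<p)
  ... | even (suc j) = subst (P ∣_) (sym (trans (cong (λ n → w b n i) p≡d+i) (w-even b (suc j) i)))
          (ℤ.∣m⇒∣m*n {m = + lucasTriangle i (suc j)} (b ℤ.^ suc j) (ℤ.∣ᵤ⇒∣ (p∣lucasTriangle i j p-prime p≡d+i)))
  ... | odd j = divides 0ℤ (trans (cong (λ n → w b n i) p≡d+i) (w-odd b j i))

  w-isEisenstein : ∀ {b} → ¬ P ∣ b → IsEisenstein (w b p ∘ suc) (ℕ.pred p)
  w-isEisenstein {b} P∤b with k , p≡ ← p-odd = record
    { P∣F<   = λ {i} i<p-1 → P∣w b (suc i) (subst (suc (suc i) ≤_) suc-pred (s≤s i<p-1))
    ; P∤Fₙ   = λ P∣Fₙ → P∤1 (subst (P ∣_)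
        (trans (cong (λ n → w b n (suc (ℕ.pred p))) (sym suc-pred)) (w-diagonal b (ℕ.pred p))) P∣Fₙ)
    ; F₀/P   = b ℤ.^ k
    ; F₀≡    = w₁≡ k p≡
    ; P∤F₀/P = P∤^ {b} k P∤b
    }
    where
    suc-pred : suc (ℕ.pred p) ≡ p
    suc-pred = ℕ.suc-pred p {{P-nonZero}}
    w₁≡ : ∀ k → p ≡ double k ℕ.+ 1 → w b p 1 ≡ b ℤ.^ k ℤ.* P
    w₁≡ k p≡ = begin
      w b p 1                           ≡⟨ cong (λ n → w b n 1) p≡ ⟩
      w b (double k ℕ.+ 1) 1            ≡⟨ w-even b k 1 ⟩
      + lucasTriangle 1 k ℤ.* b ℤ.^ k   ≡⟨ cong (λ n → + n ℤ.* b ℤ.^ k)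
                                             (trans (lucasTriangle-1 k) (trans (ℕ.+-comm 1 (double k)) (sym p≡))) ⟩
      P ℤ.* b ℤ.^ k                     ≡⟨ ℤ.*-comm P (b ℤ.^ k) ⟩
      b ℤ.^ k ℤ.* P                     ∎
      where open ≡-Reasoning

  irreducible-W/X : ∀ {b} → ¬ P ∣ b → Irreducible (drop 1 (W b p))
  irreducible-W/X {b} P∤b = eisenstein⇒irreducible p-prime (drop 1 (W b p)) (w-isEisenstein P∤b)
    (ℕ.>⇒≢ (ℕ.pred-mono-≤ (ℕ.<-trans ℕ.≤-refl p>2)))
    (λ {i} p-1<i → w-above b (subst (_≤ suc i) (cong suc (ℕ.suc-pred p {{P-nonZero}})) (s≤s p-1<i)))
    (λ i → trans (coeff-drop (W b p) i) (coeff-W b p (suc i)))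
    where
    coeff-drop : ∀ f i → coeff (drop 1 f) i ≡ coeff f (suc i)
    coeff-drop []      i = refl
    coeff-drop (a ∷ f) i = refl

  -- For odd p the constant term of `W b p` is zero by `w-odd`, so dropping the head of the list is
  -- division by X.
  W/X*X : ∀ b → drop 1 (W b p) *ᵖ X ≈ᵖ W b p
  W/X*X b n = trans (CommutativeRing.*-comm ℚ[X]-commutativeRing (drop 1 (W b p)) X n)
    (trans (coeff-X* (drop 1 (W b p)) n) (0∷drop n))
    where
    w₀≡0 : w b p 0 ≡ 0ℤ
    w₀≡0 with k , p≡ ← p-odd = trans (cong (λ n → w b n 0) p≡1+double+0) (w-odd b k 0)
      where
      p≡1+double+0 : p ≡ suc (double k) ℕ.+ 0
      p≡1+double+0 = trans p≡ (ℕ.+-suc (double k) 0)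
    0∷drop : ∀ n → coeff (0ℚ ∷ drop 1 (W b p)) n ≡ coeff (W b p) n
    0∷drop zero = sym (trans (coeff-W b p 0) (cong ι w₀≡0))
    0∷drop (suc n) with W b p
    ... | []    = refl
    ... | _ ∷ _ = refl

-- Evaluation and composition of polynomials

IsSemiringHomomorphism : ∀ {c ℓ c′ ℓ′} (R : CommutativeRing c ℓ) (S : CommutativeRing c′ ℓ′) →
  (CommutativeRing.Carrier R → CommutativeRing.Carrier S) → Set _
IsSemiringHomomorphism R S = SemiringMorphisms.IsSemiringHomomorphism
  (RawRing.rawSemiring (CommutativeRing.rawRing R)) (RawRing.rawSemiring (CommutativeRing.rawRing S))

module IsSemiringHomomorphism = SemiringMorphisms.IsSemiringHomomorphism

module Evaluation {c ℓ} (S : CommutativeRing c ℓ) {C : ℚ → CommutativeRing.Carrier S}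
  (C-isHomomorphism : IsSemiringHomomorphism ℚ.+-*-commutativeRing S C) where

  open CommutativeRing S hiding (zero) renaming (refl to ≈-refl; sym to ≈-sym; trans to ≈-trans)
  open SetoidReasoning setoid
  open CommutativeSemigroupProperties +-commutativeSemigroup
    using () renaming (interchange to +-interchange)
  open CommutativeSemigroupProperties *-commutativeSemigroup
    using () renaming (x∙yz≈y∙xz to x*[y*z]≈y*[x*z])
  private module C = IsSemiringHomomorphism C-isHomomorphism

  eval : Carrier → ℚ[X] → Carrier
  eval s []      = 0#
  eval s (a ∷ f) = C a + s * eval s f

  -- Handles trailing zeros: it settles the cases of `eval-cong` in which one list ends before the
  -- other.
  eval-zero : ∀ s f → f ≈ᵖ [] → eval s f ≈ 0#
  eval-zero s []      f≈0 = ≈-refl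
  eval-zero s (a ∷ f) f≈0 = begin
    C a + s * eval s f   ≈⟨ +-cong (≈-trans (C.⟦⟧-cong (f≈0 0)) C.0#-homo) (*-congˡ (eval-zero s f (f≈0 ∘ suc))) ⟩
    0# + s * 0#          ≈⟨ +-identityˡ _ ⟩
    s * 0#               ≈⟨ zeroʳ s ⟩
    0#                   ∎

  eval-cong : ∀ s f g → f ≈ᵖ g → eval s f ≈ eval s g
  eval-cong s []      g       f≈g = ≈-sym (eval-zero s g (λ n → sym (f≈g n)))
  eval-cong s (a ∷ f) []      f≈g = eval-zero s (a ∷ f) f≈g
  eval-cong s (a ∷ f) (b ∷ g) f≈g =
    +-cong (C.⟦⟧-cong (f≈g 0)) (*-congˡ (eval-cong s f g (f≈g ∘ suc)))

  eval-congˡ : ∀ {s t} f → s ≈ t → eval s f ≈ eval t f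
  eval-congˡ []      s≈t = ≈-refl
  eval-congˡ (a ∷ f) s≈t = +-congˡ (*-cong s≈t (eval-congˡ f s≈t))

  eval-constant : ∀ s a → eval s (a ∷ []) ≈ C a
  eval-constant s a = ≈-trans (+-congˡ (zeroʳ s)) (+-identityʳ (C a))

  eval-X : ∀ s → eval s X ≈ s
  eval-X s = begin
    C 0ℚ + s * eval s (1ℚ ∷ [])  ≈⟨ +-cong C.0#-homo (*-congˡ (≈-trans (eval-constant s 1ℚ) C.1#-homo)) ⟩
    0# + s * 1#                  ≈⟨ +-identityˡ _ ⟩
    s * 1#                       ≈⟨ *-identityʳ s ⟩
    s                            ∎

  eval-+ : ∀ s f g → eval s (f +ᵖ g) ≈ eval s f + eval s g
  eval-+ s []      g       = ≈-sym (+-identityˡ _)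
  eval-+ s (a ∷ f) []      = ≈-sym (+-identityʳ _)
  eval-+ s (a ∷ f) (b ∷ g) = begin
    C (a ℚ.+ b) + s * eval s (f +ᵖ g)
      ≈⟨ +-cong (C.+-homo a b) (≈-trans (*-congˡ (eval-+ s f g)) (distribˡ s _ _)) ⟩
    (C a + C b) + (s * eval s f + s * eval s g)
      ≈⟨ +-interchange _ _ _ _ ⟩
    (C a + s * eval s f) + (C b + s * eval s g)
      ∎

  eval-map : ∀ s a f → eval s (map (a ℚ.*_) f) ≈ C a * eval s f
  eval-map s a []      = ≈-sym (zeroʳ (C a))
  eval-map s a (b ∷ f) = begin
    C (a ℚ.* b) + s * eval s (map (a ℚ.*_) f)   ≈⟨ +-cong (C.*-homo a b) (*-congˡ (eval-map s a f)) ⟩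
    C a * C b + s * (C a * eval s f)            ≈⟨ +-congˡ (x*[y*z]≈y*[x*z] s (C a) _) ⟩
    C a * C b + C a * (s * eval s f)            ≈⟨ distribˡ (C a) _ _ ⟨
    C a * (C b + s * eval s f)                  ∎

  eval-* : ∀ s f g → eval s (f *ᵖ g) ≈ eval s f * eval s g
  eval-* s []      g = ≈-sym (zeroˡ _)
  eval-* s (a ∷ f) g = begin
    eval s (map (a ℚ.*_) g +ᵖ (0ℚ ∷ f *ᵖ g))
      ≈⟨ eval-+ s (map (a ℚ.*_) g) (0ℚ ∷ f *ᵖ g) ⟩
    eval s (map (a ℚ.*_) g) + (C 0ℚ + s * eval s (f *ᵖ g))
      ≈⟨ +-cong (eval-map s a g) (≈-trans (+-congʳ C.0#-homo) (+-identityˡ _)) ⟩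
    C a * eval s g + s * eval s (f *ᵖ g)
      ≈⟨ +-congˡ (≈-trans (*-congˡ (eval-* s f g)) (≈-sym (*-assoc s _ _))) ⟩
    C a * eval s g + s * eval s f * eval s g
      ≈⟨ distribʳ _ _ _ ⟨
    (C a + s * eval s f) * eval s g
      ∎

  eval-isSemiringHomomorphism : ∀ s → IsSemiringHomomorphism ℚ[X]-commutativeRing S (eval s)
  eval-isSemiringHomomorphism s = record
    { isNearSemiringHomomorphism = record
      { +-isMonoidHomomorphism = record
        { isMagmaHomomorphism = record
          { isRelHomomorphism = record { cong = λ {f} {g} → eval-cong s f g }
          ; homo = eval-+ s
          }
        ; ε-homo = ≈-refl
        }
      ; *-homo = eval-* s
      }
    ; 1#-homo = ≈-trans (eval-constant s 1ℚ) C.1#-homo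
    }

  homomorphism-eval : ∀ {φ} → IsSemiringHomomorphism S S φ → (∀ a → φ (C a) ≈ C a) →
                      ∀ s f → φ (eval s f) ≈ eval (φ s) f
  homomorphism-eval φ-hom φC≈C s [] = IsSemiringHomomorphism.0#-homo φ-hom
  homomorphism-eval {φ} φ-hom φC≈C s (a ∷ f) = begin
    φ (C a + s * eval s f)        ≈⟨ φ.+-homo _ _ ⟩
    φ (C a) + φ (s * eval s f)    ≈⟨ +-cong (φC≈C a) (φ.*-homo _ _) ⟩
    C a + φ s * φ (eval s f)      ≈⟨ +-congˡ (*-congˡ (homomorphism-eval φ-hom φC≈C s f)) ⟩
    C a + φ s * eval (φ s) f      ∎
    where module φ = IsSemiringHomomorphism φ-hom

-- Automorphisms, irreducibility and linear recurrences

module _ {c ℓ} (R : CommutativeRing c ℓ) where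

  open CommutativeRing R hiding (zero) renaming (refl to ≈-refl; sym to ≈-sym; trans to ≈-trans)
  open SetoidReasoning setoid
  private module R = RawSemiringDefinitions (RawRing.rawSemiring rawRing)
  open CommutativeSemigroupProperties *-commutativeSemigroup
    using () renaming (x∙yz≈y∙xz to x*[y*z]≈y*[x*z])

  -- A factorisation of `φ x` is pulled back by ψ to one of x, and the factor found to be a unit
  -- there is pushed forward again by φ.
  automorphism-irreducible : ∀ {φ ψ} → IsSemiringHomomorphism R R φ → IsSemiringHomomorphism R R ψ →
    (∀ x → ψ (φ x) ≈ x) → (∀ x → φ (ψ x) ≈ x) → ∀ {x} → R.Irreducible x → R.Irreducible (φ x)
  automorphism-irreducible {φ} {ψ} φ-hom ψ-hom ψφ≈id φψ≈id {x} irr = record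
    { p∤1 = λ φx∣1 → p∤1 (reflects-∣1 ψ-hom (ψφ≈id x) φx∣1)
    ; split-∣1 = λ {y} {z} φx≈yz →
        Sum.map (reflects-∣1 φ-hom (φψ≈id y)) (reflects-∣1 φ-hom (φψ≈id z))
          (split-∣1 (≈-trans (≈-sym (ψφ≈id x)) (≈-trans (ψ.⟦⟧-cong φx≈yz) (ψ.*-homo y z))))
    }
    where
    open R.Irreducible irr
    module ψ = IsSemiringHomomorphism ψ-hom
    reflects-∣1 : ∀ {χ} → IsSemiringHomomorphism R R χ → ∀ {x y} → χ x ≈ y → x R.∣ 1# → y R.∣ 1#
    reflects-∣1 {χ} χ-hom {x} {y} χx≈y record { quotient = q ; equality = qx≈1 } = record
      { quotient = χ q
      ; equality = begin
          χ q * y     ≈⟨ *-congˡ χx≈y ⟨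
          χ q * χ x   ≈⟨ χ.*-homo q x ⟨
          χ (q * x)   ≈⟨ χ.⟦⟧-cong qx≈1 ⟩
          χ 1#        ≈⟨ χ.1#-homo ⟩
          1#          ∎
      }
      where module χ = IsSemiringHomomorphism χ-hom

  LinearRecurrence : Carrier → Carrier → (ℕ → Carrier) → Set ℓ
  LinearRecurrence s t u = ∀ n → u (suc (suc n)) ≈ s * u (suc n) + t * u n

  linearRecurrence-unique : ∀ {s t u v} → LinearRecurrence s t u → LinearRecurrence s t v →
                            u 0 ≈ v 0 → u 1 ≈ v 1 → ∀ n → u n ≈ v n
  linearRecurrence-unique u-rec v-rec u₀≈v₀ u₁≈v₁ 0 = u₀≈v₀
  linearRecurrence-unique u-rec v-rec u₀≈v₀ u₁≈v₁ 1 = u₁≈v₁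
  linearRecurrence-unique u-rec v-rec u₀≈v₀ u₁≈v₁ (suc (suc n)) = ≈-trans (u-rec n) (≈-trans
    (+-cong (*-congˡ (linearRecurrence-unique u-rec v-rec u₀≈v₀ u₁≈v₁ (suc n)))
            (*-congˡ (linearRecurrence-unique u-rec v-rec u₀≈v₀ u₁≈v₁ n)))
    (≈-sym (v-rec n)))

  linearRecurrence-* : ∀ {s t u} c → LinearRecurrence s t u → LinearRecurrence s t (λ n → c * u n)
  linearRecurrence-* {s} {t} {u} c u-rec n = begin
    c * u (suc (suc n))                     ≈⟨ *-congˡ (u-rec n) ⟩
    c * (s * u (suc n) + t * u n)           ≈⟨ distribˡ c _ _ ⟩
    c * (s * u (suc n)) + c * (t * u n)     ≈⟨ +-cong (x*[y*z]≈y*[x*z] c s _) (x*[y*z]≈y*[x*z] c t _) ⟩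
    s * (c * u (suc n)) + t * (c * u n)     ∎

  -- Applying φ to `q * w₁ ≈ wₚ` gives the claim multiplied by c. Numerator and denominator carry
  -- the same c, so the quotient is `φ q` itself with no scalar left over.
  quotient-unscale : ∀ {φ c c⁻¹ v₁ vₚ w₁ wₚ q} → IsSemiringHomomorphism R R φ → c⁻¹ * c ≈ 1# →
    c * v₁ ≈ φ w₁ → c * vₚ ≈ φ wₚ → q * w₁ ≈ wₚ → φ q * v₁ ≈ vₚ
  quotient-unscale {φ} {c} {c⁻¹} {v₁} {vₚ} {w₁} {wₚ} {q} φ-hom c⁻¹c≈1 cv₁≈φw₁ cvₚ≈φwₚ qw₁≈wₚ = begin
    φ q * v₁                 ≈⟨ unscale (φ q * v₁) ⟨
    c⁻¹ * (c * (φ q * v₁))   ≈⟨ *-congˡ (x*[y*z]≈y*[x*z] c (φ q) v₁) ⟩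
    c⁻¹ * (φ q * (c * v₁))   ≈⟨ *-congˡ (*-congˡ cv₁≈φw₁) ⟩
    c⁻¹ * (φ q * φ w₁)       ≈⟨ *-congˡ (≈-trans (≈-sym (φ.*-homo q w₁)) (φ.⟦⟧-cong qw₁≈wₚ)) ⟩
    c⁻¹ * φ wₚ               ≈⟨ *-congˡ cvₚ≈φwₚ ⟨
    c⁻¹ * (c * vₚ)           ≈⟨ unscale vₚ ⟩
    vₚ                       ∎
    where
    module φ = IsSemiringHomomorphism φ-hom
    unscale : ∀ x → c⁻¹ * (c * x) ≈ x
    unscale x = ≈-trans (≈-sym (*-assoc c⁻¹ c x)) (≈-trans (*-congʳ c⁻¹c≈1) (*-identityˡ x))

-- Substitution and its inverse in ℚ[X]

module ℚ[X] = CommutativeRing ℚ[X]-commutativeRing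

constant-isSemiringHomomorphism : IsSemiringHomomorphism ℚ.+-*-commutativeRing ℚ[X]-commutativeRing (_∷ [])
constant-isSemiringHomomorphism = record
  { isNearSemiringHomomorphism = record
    { +-isMonoidHomomorphism = record
      { isMagmaHomomorphism = record
        { isRelHomomorphism = record { cong = λ a≡b → ℚ[X].reflexive (cong (_∷ []) a≡b) }
        ; homo = λ a b n → refl
        }
      ; ε-homo = λ { zero → refl ; (suc n) → refl }
      }
    ; *-homo = λ a b → λ
      { zero    → sym (const-*ᵖ a (b ∷ []) 0)
      ; (suc n) → sym (trans (const-*ᵖ a (b ∷ []) (suc n)) (ℚ.*-zeroʳ a))
      }
    }
  ; 1#-homo = λ _ → refl
  }

open Evaluation ℚ[X]-commutativeRing constant-isSemiringHomomorphism
  renaming (eval to compose)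

compose-identity : ∀ f → compose X f ≈ᵖ f
compose-identity []      n = refl
compose-identity (a ∷ f) n = trans (coeff-+ (a ∷ []) (X *ᵖ compose X f) n)
  (trans (cong (coeff (a ∷ []) n ℚ.+_) (coeff-X* (compose X f) n)) (step n))
  where
  step : ∀ n → coeff (a ∷ []) n ℚ.+ coeff (0ℚ ∷ compose X f) n ≡ coeff (a ∷ f) n
  step zero    = ℚ.+-identityʳ a
  step (suc n) = trans (ℚ.+-identityˡ (coeff (compose X f) n)) (compose-identity f n)

-- `compose g f` is f(g(X)), with the inner polynomial first. The homomorphism `compose h` fixes
-- constants, so it moves inside and replaces g by g(h(X)), which is X.
compose-cancel : ∀ g h → compose h g ≈ᵖ X → ∀ f → compose h (compose g f) ≈ᵖ f
compose-cancel g h g∘h≈X f n = trans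
  (homomorphism-eval {compose h} (eval-isSemiringHomomorphism h) (eval-constant h) g f n)
  (trans (eval-congˡ {compose h g} {X} f g∘h≈X n) (compose-identity f n))

-- The sequence V is n ↦ W b n up to a scalar and an invertible affine change of variable.
record IsLucasFamily (V : ℕ → ℚ[X]) : Set where
  field
    b         : ℤ
    c c⁻¹     : ℚ
    L L⁻¹     : ℚ[X]
    c⁻¹*c≡1   : c⁻¹ ℚ.* c ≡ 1ℚ
    L∘L⁻¹≈X   : compose L⁻¹ L ≈ᵖ X
    L⁻¹∘L≈X   : compose L L⁻¹ ≈ᵖ X
    V-zero    : (c ∷ []) *ᵖ V 0 ≈ᵖ const (+ 2)
    V-one     : (c ∷ []) *ᵖ V 1 ≈ᵖ L
    V-rec     : LinearRecurrence ℚ[X]-commutativeRing L (const b) V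

  compose-L-isHomomorphism : IsSemiringHomomorphism ℚ[X]-commutativeRing ℚ[X]-commutativeRing (compose L)
  compose-L-isHomomorphism = eval-isSemiringHomomorphism L

  W∘L-rec : LinearRecurrence ℚ[X]-commutativeRing L (const b) (λ n → compose L (W b n))
  W∘L-rec n = begin
    compose L (X *ᵖ W b (suc n) +ᵖ const b *ᵖ W b n)
      ≈⟨ eval-+ L (X *ᵖ W b (suc n)) (const b *ᵖ W b n) ⟩
    compose L (X *ᵖ W b (suc n)) +ᵖ compose L (const b *ᵖ W b n)
      ≈⟨ ℚ[X].+-cong {compose L (X *ᵖ W b (suc n))} {compose L X *ᵖ compose L (W b (suc n))}
           {compose L (const b *ᵖ W b n)} {compose L (const b) *ᵖ compose L (W b n)}
           (eval-* L X (W b (suc n))) (eval-* L (const b) (W b n)) ⟩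
    compose L X *ᵖ compose L (W b (suc n)) +ᵖ compose L (const b) *ᵖ compose L (W b n)
      ≈⟨ ℚ[X].+-cong {compose L X *ᵖ compose L (W b (suc n))} {L *ᵖ compose L (W b (suc n))}
           {compose L (const b) *ᵖ compose L (W b n)} {const b *ᵖ compose L (W b n)}
           (ℚ[X].*-congʳ {compose L (W b (suc n))} {compose L X} {L} (eval-X L))
           (ℚ[X].*-congʳ {compose L (W b n)} {compose L (const b)} {const b} (eval-constant L (ι b))) ⟩
    L *ᵖ compose L (W b (suc n)) +ᵖ const b *ᵖ compose L (W b n)
      ∎
    where open SetoidReasoning ℚ[X].setoid

  -- Both sides solve the recurrence with multipliers L and b, and their first two values are 2 and
  -- L.
  V≈W∘L : ∀ n → (c ∷ []) *ᵖ V n ≈ᵖ compose L (W b n)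
  V≈W∘L = linearRecurrence-unique ℚ[X]-commutativeRing {L} {const b}
    {λ n → (c ∷ []) *ᵖ V n} {λ n → compose L (W b n)}
    (linearRecurrence-* ℚ[X]-commutativeRing {L} {const b} {V} (c ∷ []) V-rec) W∘L-rec
    (λ n → trans (V-zero n) (sym (eval-constant L (ι (+ 2)) n)))
    (λ n → trans (V-one n) (sym (eval-X L n)))

  irreducibleQuotient : ∀ {p} → Prime p → p > 2 → ¬ (+ p ∣ b) → IrreducibleQuotient (V p) (V 1)
  irreducibleQuotient {p} p-prime p>2 p∤b =
    record
      { quotient = compose L W/X
      ; equality = quotient-unscale ℚ[X]-commutativeRing {compose L} {c ∷ []} {c⁻¹ ∷ []} {V 1} {V p}
          {X} {W b p} {W/X} compose-L-isHomomorphism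
          (λ n → trans (sym (*-homo c⁻¹ c n)) (cong (λ a → coeff (a ∷ []) n) c⁻¹*c≡1))
          (V≈W∘L 1) (V≈W∘L p) (W/X*X p-prime p>2 b)
      } ,
    automorphism-irreducible ℚ[X]-commutativeRing {compose L} {compose L⁻¹}
      compose-L-isHomomorphism (eval-isSemiringHomomorphism L⁻¹)
      (compose-cancel L L⁻¹ L∘L⁻¹≈X) (compose-cancel L⁻¹ L L⁻¹∘L≈X) {W/X}
      (irreducible-W/X p-prime p>2 p∤b)
    where
    W/X = drop 1 (W b p)
    open IsSemiringHomomorphism constant-isSemiringHomomorphism using (*-homo)

-- The six sequences

∤-small : ∀ {p b} → p > 2 → 0 < ℤ.∣ b ∣ → ℤ.∣ b ∣ ≤ 2 → ¬ (+ p ∣ b)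
∤-small {p} {b} p>2 0<b b≤2 p∣b = ℕ.>⇒∤ {{ℕ.>-nonZero 0<b}} (ℕ.≤-<-trans b≤2 p>2) (ℤ.∣⇒∣ᵤ p∣b)

+ᵖ≈+ᵖ1* : ∀ f g → f +ᵖ g ≈ᵖ f +ᵖ const (+ 1) *ᵖ g
+ᵖ≈+ᵖ1* f g = ℚ[X].+-congˡ {f} {g} {const (+ 1) *ᵖ g} (ℚ[X].sym {const (+ 1) *ᵖ g} {g} (ℚ[X].*-identityˡ g))

-ᵖ≈+ᵖ-1* : ∀ f g → f -ᵖ g ≈ᵖ f +ᵖ const (-[1+ 0 ]) *ᵖ g
-ᵖ≈+ᵖ-1* f g = ℚ[X].+-congˡ {f} { -ᵖ g} {const (-[1+ 0 ]) *ᵖ g} λ n →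
  trans (coeff-neg g n) (trans (cong ℚ.-_ (sym (ℚ.*-identityˡ (coeff g n))))
    (trans (ℚ.neg-distribˡ-* 1ℚ (coeff g n)) (sym (const-*ᵖ (ι -[1+ 0 ]) g n))))

lucas-isLucasFamily : IsLucasFamily lucas
lucas-isLucasFamily = record
  { b = + 1 ; c = 1ℚ ; c⁻¹ = 1ℚ ; L = X ; L⁻¹ = X
  ; c⁻¹*c≡1 = refl
  ; L∘L⁻¹≈X = eval-X X ; L⁻¹∘L≈X = eval-X X
  ; V-zero = ℚ[X].*-identityˡ (lucas 0)
  ; V-one = ℚ[X].*-identityˡ (lucas 1)
  ; V-rec = λ n → +ᵖ≈+ᵖ1* (X *ᵖ lucas (suc n)) (lucas n)
  }

pellLucas-isLucasFamily : IsLucasFamily pellLucas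
pellLucas-isLucasFamily = record
  { b = + 1 ; c = 1ℚ ; c⁻¹ = 1ℚ ; L = const (+ 2) *ᵖ X ; L⁻¹ = 0ℚ ∷ ℚ.½ ∷ []
  ; c⁻¹*c≡1 = refl
  -- The composite evaluates to a closed list of three entries whose last is a trailing zero, hence
  -- the separate case for index 2.
  ; L∘L⁻¹≈X = λ { 0 → refl ; 1 → refl ; 2 → refl ; (suc (suc (suc n))) → refl }
  ; L⁻¹∘L≈X = λ { 0 → refl ; 1 → refl ; 2 → refl ; (suc (suc (suc n))) → refl }
  ; V-zero = ℚ[X].*-identityˡ (pellLucas 0)
  ; V-one = ℚ[X].*-identityˡ (pellLucas 1)
  ; V-rec = λ n → +ᵖ≈+ᵖ1* (const (+ 2) *ᵖ X *ᵖ pellLucas (suc n)) (pellLucas n)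
  }

fermatLucas-isLucasFamily : IsLucasFamily fermatLucas
fermatLucas-isLucasFamily = record
  { b = -[1+ 1 ] ; c = 1ℚ ; c⁻¹ = 1ℚ ; L = const (+ 3) *ᵖ X ; L⁻¹ = 0ℚ ∷ (+ 1 ℚ./ 3) ∷ []
  ; c⁻¹*c≡1 = refl
  ; L∘L⁻¹≈X = λ { 0 → refl ; 1 → refl ; 2 → refl ; (suc (suc (suc n))) → refl }
  ; L⁻¹∘L≈X = λ { 0 → refl ; 1 → refl ; 2 → refl ; (suc (suc (suc n))) → refl }
  ; V-zero = ℚ[X].*-identityˡ (fermatLucas 0)
  ; V-one = ℚ[X].*-identityˡ (fermatLucas 1)
  ; V-rec = λ n → ℚ[X].+-congˡ {const (+ 3) *ᵖ X *ᵖ fermatLucas (suc n)}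
      { -ᵖ (const (+ 2) *ᵖ fermatLucas n)} {const (-[1+ 1 ]) *ᵖ fermatLucas n}
      (-‿distribˡ-* (const (+ 2)) (fermatLucas n))
  }
  where open import Algebra.Properties.Ring ℚ[X].ring using (-‿distribˡ-*)

chebyshevT-isLucasFamily : IsLucasFamily chebyshevT
chebyshevT-isLucasFamily = record
  -- T starts with 1 instead of 2, so it is 2 T_n that satisfies 2 T_n(x) = W_n(2x); the other five
  -- sequences already start with 2.
  { b = -[1+ 0 ] ; c = ι (+ 2) ; c⁻¹ = ℚ.½ ; L = const (+ 2) *ᵖ X ; L⁻¹ = 0ℚ ∷ ℚ.½ ∷ []
  ; c⁻¹*c≡1 = refl
  ; L∘L⁻¹≈X = λ { 0 → refl ; 1 → refl ; 2 → refl ; (suc (suc (suc n))) → refl }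
  ; L⁻¹∘L≈X = λ { 0 → refl ; 1 → refl ; 2 → refl ; (suc (suc (suc n))) → refl }
  ; V-zero = ℚ[X].*-identityʳ (const (+ 2))
  ; V-one = ℚ[X].refl {const (+ 2) *ᵖ X}
  ; V-rec = λ n → -ᵖ≈+ᵖ-1* (const (+ 2) *ᵖ X *ᵖ chebyshevT (suc n)) (chebyshevT n)
  }

morganVoyceC-isLucasFamily : IsLucasFamily morganVoyceC
morganVoyceC-isLucasFamily = record
  -- Here the change of variable is a translation, C_n(x) = W_n(x + 2), undone by x - 2.
  { b = -[1+ 0 ] ; c = 1ℚ ; c⁻¹ = 1ℚ ; L = X +ᵖ const (+ 2) ; L⁻¹ = X -ᵖ const (+ 2)
  ; c⁻¹*c≡1 = refl
  ; L∘L⁻¹≈X = λ { 0 → refl ; 1 → refl ; 2 → refl ; (suc (suc (suc n))) → refl }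
  ; L⁻¹∘L≈X = λ { 0 → refl ; 1 → refl ; 2 → refl ; (suc (suc (suc n))) → refl }
  ; V-zero = ℚ[X].*-identityˡ (morganVoyceC 0)
  ; V-one = ℚ[X].*-identityˡ (morganVoyceC 1)
  ; V-rec = λ n → -ᵖ≈+ᵖ-1* ((X +ᵖ const (+ 2)) *ᵖ morganVoyceC (suc n)) (morganVoyceC n)
  }

vietaLucas-isLucasFamily : IsLucasFamily vietaLucas
vietaLucas-isLucasFamily = record
  { b = -[1+ 0 ] ; c = 1ℚ ; c⁻¹ = 1ℚ ; L = X ; L⁻¹ = X
  ; c⁻¹*c≡1 = refl
  ; L∘L⁻¹≈X = eval-X X ; L⁻¹∘L≈X = eval-X X
  ; V-zero = ℚ[X].*-identityˡ (vietaLucas 0)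
  ; V-one = ℚ[X].*-identityˡ (vietaLucas 1)
  ; V-rec = λ n → -ᵖ≈+ᵖ-1* (X *ᵖ vietaLucas (suc n)) (vietaLucas n)
  }

mainTheorem10 : ∀ (p : ℕ) → Prime p → p > 2 →
    IrreducibleQuotient (lucas p) (lucas 1)
    × IrreducibleQuotient (pellLucas p) (pellLucas 1)
    × IrreducibleQuotient (fermatLucas p) (fermatLucas 1)
    × IrreducibleQuotient (chebyshevT p) (chebyshevT 1)
    × IrreducibleQuotient (morganVoyceC p) (morganVoyceC 1)
    × IrreducibleQuotient (vietaLucas p) (vietaLucas 1)
mainTheorem10 p p-prime p>2 =
  irreducibleQuotient lucas-isLucasFamily        p-prime p>2 (∤-small p>2 z<s (s≤s z≤n)) ,
  irreducibleQuotient pellLucas-isLucasFamily    p-prime p>2 (∤-small p>2 z<s (s≤s z≤n)) ,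
  irreducibleQuotient fermatLucas-isLucasFamily  p-prime p>2 (∤-small p>2 z<s ℕ.≤-refl) ,
  irreducibleQuotient chebyshevT-isLucasFamily   p-prime p>2 (∤-small p>2 z<s (s≤s z≤n)) ,
  irreducibleQuotient morganVoyceC-isLucasFamily p-prime p>2 (∤-small p>2 z<s (s≤s z≤n)) ,
  irreducibleQuotient vietaLucas-isLucasFamily   p-prime p>2 (∤-small p>2 z<s (s≤s z≤n))
  where open IsLucasFamily
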